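{- Let $n=3M$, let $f(X_1,\dots,X_n)$ be the logical formula in Laurent form associated with a CNF formula with $M$ clauses of three literals each, let $C$ be its constant term, let $a_1,\dots,a_n$ be pairwise different real numbers, and let $z(a_1),\dots,z(a_n)$ be their integerizations. Let $l$ be a positive integer. If $$1\le |z(A_k)|=\Bigl|\sum_{j=1}^{n}e_j\,z(a_j)\Bigr|<l\qquad(e_j=-1,0\text{ or }1)$$ for all $k$ ($1\le k\le 3^n-1$), then $$\sum_{m=1}^{l}f=\sum_{m=1}^{l}\Bigl(\sum_{k=1}^{3^n-1}q_k\exp\Bigl(i\,z(A_k)\frac{2\pi}{l}m\Bigr)+C\Bigr)=lC,$$ where in the $m$-th summand $f$ is evaluated at $X_j=\exp\bigl(i\,z(a_j)\frac{2\pi}{l}m\bigr)$, $1\le j\le n$.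
   Context: The logical formula in Laurent form: given a CNF formula with $M$ clauses of three literals each and $N$ variables (the $s$-th one occurring $r_s\ge1$ times), number the literal occurrences $1,\dots,3M$ (clause $c$ consists of occurrences $3c-2,3c-1,3c$), assign to the $a$-th occurrence (positive or negated) a variable $X_a$, let $X_{st}$ be the variable assigned to the $t$-th occurrence of the $s$-th old variable, and $\varepsilon_{st}=1$ or $-1$ according to whether that occurrence is positive or negative. Then $$f=\frac{1}{2^{6M-1}}\prod_{c=1}^{M}\bigl((X_{3c-2}-1)(X_{3c-1}-1)(X_{3c}-1)+8\bigr)\prod_{s=1}^{N}\Bigl(\prod_{t=1}^{r_s}\bigl(\tfrac{\varepsilon_{st}}{X_{st}}+1\bigr)+\prod_{t=1}^{r_s}\bigl(-\tfrac{\varepsilon_{st}}{X_{st}}+1\bigr)\Bigr)-1 .$$ It expands as $f=\sum_{k=1}^{3^n-1}q_k\prod_{j=1}^nX_j^{e_j}+C$, where $k$ enumerates the non-zero vectors $(e_1,\dots,e_n)\in\{ -1,0,1\}^n$ (the vector depending on $k$), $q_k$ are coefficients (possibly $0$), and $C$ is the constant term. Integerization: all $a_j$ are multiplied by one certain integer and rounded to non-zero integers $z(a_j)$. For the vector $(e_j)$ belonging to $k$, $A_k=\sum_{j=1}^ne_ja_j$ and $z(A_k)=\sum_{j=1}^ne_j\,z(a_j)$. -}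

module Defs where

open import Algebra.Apartness.Bundles using (HeytingField)
open import Algebra.Bundles using (CommutativeRing; module Semiring)
import Algebra.Definitions
import Algebra.Definitions.RawSemiring
open import Algebra.Properties.AbelianGroup using (ε⁻¹≈ε)
import Algebra.Properties.Ring
import Algebra.Solver.Ring.NaturalCoefficients.Default
open import Data.Fin.Base using (Fin; toℕ; combine)
open import Data.Fin.Patterns using (0F; 1F; 2F)
import Data.Fin.Properties as Fin
open import Data.Integer.Base as ℤ using (ℤ; +_; -[1+_]; ∣_∣)
import Data.Integer.Properties as ℤ
open import Data.List.Base as List using (List; []; _∷_; _++_; cartesianProductWith)
open import Data.Nat.Base as ℕ using (ℕ; zero; suc; NonZero; _!)
import Data.Nat.Properties as ℕ
open import Data.Product.Base using (∃; _×_; _,_; proj₁; proj₂)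
open import Data.Sign.Base as Sign using (Sign)
open import Data.Sum.Base using (_⊎_)
open import Data.Vec.Base as Vec using (Vec; lookup; replicate; zipWith; _[_]≔_)
import Data.Vec.Properties as Vec
import Data.Vec.Relation.Unary.All as VecAll
open import Function.Base using (_∘_)
open import Function.Definitions using (Injective)
open import Level using (Level; _⊔_) renaming (suc to lsuc)
open import Relation.Binary.Core using (Rel)
open import Relation.Binary.PropositionalEquality.Core using (_≡_; _≢_)
open import Relation.Binary.Structures using (IsEquivalence; IsStrictPartialOrder)
open import Relation.Nullary.Negation using (¬_)

module RingOps {c ℓ : Level} (R : CommutativeRing c ℓ) where
  open CommutativeRing R
  open Algebra.Definitions.RawSemiring (Semiring.rawSemiring semiring) public
    using (sum; product; _^_) renaming (_×_ to _·_)
  open Algebra.Definitions _≈_ using (Invertible)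

  fromℕ : ℕ → Carrier
  fromℕ k = k · 1#

  fromℤ : ℤ → Carrier
  fromℤ (+ k)    = fromℕ k
  fromℤ -[1+ k ] = - fromℕ (suc k)

  IsUnit : Carrier → Set (c ⊔ ℓ)
  IsUnit = Invertible 1# _*_

  zpow : (x : Carrier) → IsUnit x → ℤ → Carrier
  zpow x _         (+ k)    = x ^ k
  zpow x (x⁻¹ , _) -[1+ k ] = x⁻¹ ^ suc k

------------------------------------------------------------------------
-- Real numbers: an Archimedean, Cauchy-complete ordered field.  The
-- axioms determine ℝ up to isomorphism; they are phrased so that both
-- the classical and the (Bishop) constructive reals satisfy them.

record RealNumbers (c ℓ₁ ℓ₂ ℓ₃ : Level) : Set (lsuc (c ⊔ ℓ₁ ⊔ ℓ₂ ⊔ ℓ₃)) where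
  infix 4 _<_
  field
    heytingField : HeytingField c ℓ₁ ℓ₂

  open HeytingField heytingField public

  commutativeRing : CommutativeRing c ℓ₁
  commutativeRing = record { isCommutativeRing = isCommutativeRing }

  field
    _<_                  : Rel Carrier ℓ₃
    isStrictPartialOrder : IsStrictPartialOrder _≈_ _<_
    #⇒<⊎>                : ∀ {x y} → x # y → x < y ⊎ y < x
    <⇒#                  : ∀ {x y} → x < y → x # y
    0<1                  : 0# < 1#
    +-monoˡ-<            : ∀ {x y} z → x < y → x + z < y + z
    *-pos                : ∀ {x y} → 0# < x → 0# < y → 0# < x * y

  ∣_∣<_ : Carrier → Carrier → Set ℓ₃
  ∣ x ∣< ε = (- ε < x) × (x < ε)

  IsCauchy : (ℕ → Carrier) → Set (c ⊔ ℓ₃)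
  IsCauchy s = ∀ ε → 0# < ε →
    ∃ λ K → ∀ p q → K ℕ.≤ p → K ℕ.≤ q → ∣ s p - s q ∣< ε

  _⟶_ : (ℕ → Carrier) → Carrier → Set (c ⊔ ℓ₃)
  s ⟶ x = ∀ ε → 0# < ε → ∃ λ K → ∀ p → K ℕ.≤ p → ∣ s p - x ∣< ε

  field
    archimedean : ∀ x → ∃ λ k → x < RingOps.fromℕ commutativeRing k
    complete    : ∀ s → IsCauchy s → ∃ λ x → s ⟶ x

  open RingOps commutativeRing public using (fromℕ; fromℤ)
  open CommutativeRing commutativeRing public
    using (ring; commutativeSemiring; +-abelianGroup)
  open IsStrictPartialOrder isStrictPartialOrder
    using (<-respʳ-≈; <-respˡ-≈) renaming (trans to <-trans)

  0<fromℕ : ∀ k → 0# < fromℕ (suc k)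
  0<fromℕ zero    = <-respʳ-≈ (sym (+-identityʳ 1#)) 0<1
  0<fromℕ (suc k) = <-trans (0<fromℕ k)
    (<-respˡ-≈ (+-identityˡ _) (+-monoˡ-< (fromℕ (suc k)) 0<1))

  private
    -- `#⇒invertible` inverts the difference x - 0#.
    inverse : ∀ k → RingOps.IsUnit commutativeRing (fromℕ (suc k) - 0#)
    inverse k = #⇒invertible (#-sym (<⇒# (0<fromℕ k)))

  recip : (k : ℕ) .{{_ : NonZero k}} → Carrier
  recip (suc k) = proj₁ (inverse k)

  recip-inverse : ∀ k → recip (suc k) * fromℕ (suc k) ≈ 1#
  recip-inverse k = trans (*-congˡ (sym x-0≈x)) (proj₁ (proj₂ (inverse k)))
    where
    x-0≈x : fromℕ (suc k) - 0# ≈ fromℕ (suc k)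
    x-0≈x = trans (+-congˡ (ε⁻¹≈ε +-abelianGroup)) (+-identityʳ _)

module ComplexNumbers {c ℓ₁ ℓ₂ ℓ₃ : Level} (R : RealNumbers c ℓ₁ ℓ₂ ℓ₃) where
  private module ℝ = RealNumbers R

  infix 4 _≈ᶜ_

  record ℂ : Set c where
    constructor _+i_
    field
      re im : ℝ.Carrier
  open ℂ public

  record _≈ᶜ_ (z w : ℂ) : Set ℓ₁ where
    constructor _,_
    field
      re≈ : re z ℝ.≈ re w
      im≈ : im z ℝ.≈ im w
  open _≈ᶜ_ public

  ofReal : ℝ.Carrier → ℂ
  ofReal x = x +i ℝ.0#

  i : ℂ
  i = ℝ.0# +i ℝ.1#

  private
    _+ᶜ_ _*ᶜ_ : ℂ → ℂ → ℂ
    (a +i b) +ᶜ (c +i d) = (a ℝ.+ c) +i (b ℝ.+ d)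
    (a +i b) *ᶜ (c +i d) =
      (a ℝ.* c ℝ.- b ℝ.* d) +i (a ℝ.* d ℝ.+ b ℝ.* c)

    -ᶜ_ : ℂ → ℂ
    -ᶜ (a +i b) = (ℝ.- a) +i (ℝ.- b)

    isEquivalence : IsEquivalence _≈ᶜ_
    isEquivalence = record
      { refl  = ℝ.refl , ℝ.refl
      ; sym   = λ p → ℝ.sym (re≈ p) , ℝ.sym (im≈ p)
      ; trans = λ p q → ℝ.trans (re≈ p) (re≈ q) , ℝ.trans (im≈ p) (im≈ q)
      }

    open Algebra.Solver.Ring.NaturalCoefficients.Default ℝ.commutativeSemiring
    open Algebra.Properties.Ring ℝ.ring using (-1*x≈-x)

    -1ℝ : ℝ.Carrier
    -1ℝ = ℝ.- ℝ.1#

    neg : ∀ {x y} → x ℝ.≈ y → ℝ.- x ℝ.≈ -1ℝ ℝ.* y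
    neg p = ℝ.trans (ℝ.-‿cong p) (ℝ.sym (-1*x≈-x _))

    sub : ∀ x y → x ℝ.- y ℝ.≈ x ℝ.+ -1ℝ ℝ.* y
    sub x y = ℝ.+-congˡ (neg ℝ.refl)

    *ᶜ-comm : ∀ z w → (z *ᶜ w) ≈ᶜ (w *ᶜ z)
    *ᶜ-comm (a +i b) (c +i d) =
      ℝ.+-cong (ℝ.*-comm a c) (ℝ.-‿cong (ℝ.*-comm b d)) ,
      solve 4 (λ a b c d → a :* d :+ b :* c := c :* b :+ d :* a)
        ℝ.refl a b c d

    *ᶜ-assoc : ∀ z w u → ((z *ᶜ w) *ᶜ u) ≈ᶜ (z *ᶜ (w *ᶜ u))
    *ᶜ-assoc (a +i b) (c +i d) (e +i f) =
      ℝ.trans (ℝ.+-cong (ℝ.*-congʳ (sub _ _)) (neg ℝ.refl))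
        (ℝ.trans
          (solve 7 (λ n a b c d e f →
              (a :* c :+ n :* (b :* d)) :* e :+ n :* ((a :* d :+ b :* c) :* f)
           := a :* (c :* e :+ n :* (d :* f)) :+ n :* (b :* (c :* f :+ d :* e)))
            ℝ.refl -1ℝ a b c d e f)
          (ℝ.sym (ℝ.+-cong (ℝ.*-congˡ (sub _ _)) (neg ℝ.refl)))) ,
      ℝ.trans (ℝ.+-congʳ (ℝ.*-congʳ (sub _ _)))
        (ℝ.trans
          (solve 7 (λ n a b c d e f →
              (a :* c :+ n :* (b :* d)) :* f :+ (a :* d :+ b :* c) :* e
           := a :* (c :* f :+ d :* e) :+ b :* (c :* e :+ n :* (d :* f)))
            ℝ.refl -1ℝ a b c d e f)
          (ℝ.sym (ℝ.+-congˡ (ℝ.*-congˡ (sub _ _)))))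

    *ᶜ-identityˡ : ∀ z → (ofReal ℝ.1# *ᶜ z) ≈ᶜ z
    *ᶜ-identityˡ (a +i b) =
      ℝ.trans (ℝ.+-cong (ℝ.*-identityˡ a) (ℝ.-‿cong (ℝ.zeroˡ b)))
        (ℝ.trans (ℝ.+-congˡ (ε⁻¹≈ε ℝ.+-abelianGroup)) (ℝ.+-identityʳ a)) ,
      ℝ.trans (ℝ.+-cong (ℝ.*-identityˡ b) (ℝ.zeroˡ a)) (ℝ.+-identityʳ b)

    *ᶜ-distribˡ : ∀ z w u → (z *ᶜ (w +ᶜ u)) ≈ᶜ ((z *ᶜ w) +ᶜ (z *ᶜ u))
    *ᶜ-distribˡ (a +i b) (c +i d) (e +i f) =
      ℝ.trans (sub _ _)
        (ℝ.trans
          (solve 7 (λ n a b c d e f →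
              a :* (c :+ e) :+ n :* (b :* (d :+ f))
           := (a :* c :+ n :* (b :* d)) :+ (a :* e :+ n :* (b :* f)))
            ℝ.refl -1ℝ a b c d e f)
          (ℝ.sym (ℝ.+-cong (sub _ _) (sub _ _)))) ,
      solve 6 (λ a b c d e f →
          a :* (d :+ f) :+ b :* (c :+ e)
       := (a :* d :+ b :* c) :+ (a :* f :+ b :* e))
        ℝ.refl a b c d e f

    *ᶜ-cong : ∀ {z z′ w w′} → z ≈ᶜ z′ → w ≈ᶜ w′ → (z *ᶜ w) ≈ᶜ (z′ *ᶜ w′)
    *ᶜ-cong (p , q) (r , s) =
      ℝ.+-cong (ℝ.*-cong p r) (ℝ.-‿cong (ℝ.*-cong q s)) ,
      ℝ.+-cong (ℝ.*-cong p s) (ℝ.*-cong q r)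

    module ≈ᶜ = IsEquivalence isEquivalence

  ℂ-ring : CommutativeRing c ℓ₁
  ℂ-ring = record
    { Carrier = ℂ
    ; _≈_     = _≈ᶜ_
    ; _+_     = _+ᶜ_
    ; _*_     = _*ᶜ_
    ; -_      = -ᶜ_
    ; 0#      = ofReal ℝ.0#
    ; 1#      = ofReal ℝ.1#
    ; isCommutativeRing = record
      { isRing = record
        { +-isAbelianGroup = record
          { isGroup = record
            { isMonoid = record
              { isSemigroup = record
                { isMagma = record
                  { isEquivalence = isEquivalence
                  ; ∙-cong = λ p q → ℝ.+-cong (re≈ p) (re≈ q)
                                   , ℝ.+-cong (im≈ p) (im≈ q)
                  }
                ; assoc = λ _ _ _ → ℝ.+-assoc _ _ _ , ℝ.+-assoc _ _ _
                }
              ; identity = (λ _ → ℝ.+-identityˡ _ , ℝ.+-identityˡ _)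
                         , (λ _ → ℝ.+-identityʳ _ , ℝ.+-identityʳ _)
              }
            ; inverse = (λ _ → ℝ.-‿inverseˡ _ , ℝ.-‿inverseˡ _)
                      , (λ _ → ℝ.-‿inverseʳ _ , ℝ.-‿inverseʳ _)
            ; ⁻¹-cong = λ p → ℝ.-‿cong (re≈ p) , ℝ.-‿cong (im≈ p)
            }
          ; comm = λ _ _ → ℝ.+-comm _ _ , ℝ.+-comm _ _
          }
        ; *-cong     = *ᶜ-cong
        ; *-assoc    = *ᶜ-assoc
        ; *-identity = *ᶜ-identityˡ
                     , (λ z → ≈ᶜ.trans (*ᶜ-comm z _) (*ᶜ-identityˡ z))
        ; distrib    = *ᶜ-distribˡ
                     , (λ z w u → ≈ᶜ.trans (*ᶜ-comm (w +ᶜ u) z)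
                         (≈ᶜ.trans (*ᶜ-distribˡ z w u)
                           ( ℝ.+-cong (re≈ (*ᶜ-comm z w)) (re≈ (*ᶜ-comm z u))
                           , ℝ.+-cong (im≈ (*ᶜ-comm z w)) (im≈ (*ᶜ-comm z u)))))
        }
      ; *-comm = *ᶜ-comm
      }
    }

  open RingOps ℂ-ring using (sum; _^_)

  _⟶ᶜ_ : (ℕ → ℂ) → ℂ → Set (c ⊔ ℓ₃)
  s ⟶ᶜ w = ((re ∘ s) ℝ.⟶ re w) × ((im ∘ s) ℝ.⟶ im w)

  expPartialSum : ℂ → ℕ → ℂ
  expPartialSum w K = sum {K} λ k →
    (w ^ toℕ k) *ᶜ ofReal (ℝ.recip (toℕ k !) {{toℕ k ℕ.!≢0}})

  IsExp : (ℂ → ℂ) → Set (c ⊔ ℓ₃)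
  IsExp exp = ∀ w → expPartialSum w ⟶ᶜ exp w

  -- π is the smallest positive zero of sin x = Im (exp (i x)).
  record IsPi (exp : ℂ → ℂ) (π : ℝ.Carrier) : Set (c ⊔ ℓ₁ ⊔ ℓ₃) where
    sin : ℝ.Carrier → ℝ.Carrier
    sin x = im (exp (i *ᶜ ofReal x))
    field
      positive : ℝ.0# ℝ.< π
      zero-π   : sin π ℝ.≈ ℝ.0#
      smallest : ∀ x → ℝ.0# ℝ.< x → x ℝ.< π → ¬ (sin x ℝ.≈ ℝ.0#)

  expAt : (exp : ℂ → ℂ) (π : ℝ.Carrier) (l : ℕ) .{{_ : NonZero l}} →
          ℤ → ℕ → ℂ
  expAt exp π l w m =
    exp (i *ᶜ ofReal (ℝ.fromℤ w ℝ.* (ℝ.fromℕ 2 ℝ.* π ℝ.* ℝ.recip l) ℝ.* ℝ.fromℕ m))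

------------------------------------------------------------------------
-- Laurent polynomials in n variables, as formal sums of terms c X^e;
-- the same exponent vector may occur in several terms.

module LaurentPolynomials {c ℓ : Level} (R : CommutativeRing c ℓ) (n : ℕ) where
  open CommutativeRing R
  open RingOps R

  Laurent : Set c
  Laurent = List (Carrier × Vec ℤ n)

  const : Carrier → Laurent
  const a = (a , replicate n ℤ.0ℤ) ∷ []

  X[_]^_ : Fin n → ℤ → Laurent
  X[ j ]^ k = (1# , (replicate n ℤ.0ℤ [ j ]≔ k)) ∷ []

  infixl 6 _⊕_
  infixl 7 _⊗_

  _⊕_ _⊗_ : Laurent → Laurent → Laurent
  _⊕_ = _++_
  _⊗_ = cartesianProductWith λ (a , d) (b , e) → a * b , zipWith ℤ._+_ d e

  ∏ : List Laurent → Laurent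
  ∏ = List.foldr _⊗_ (const 1#)

  coeff : Laurent → Vec ℤ n → Carrier
  coeff p e = List.foldr _+_ 0#
    (List.map proj₁ (List.filter (λ t → Vec.≡-dec ℤ._≟_ (proj₂ t) e) p))

  constantTerm : Laurent → Carrier
  constantTerm p = coeff p (replicate n ℤ.0ℤ)

  eval : Laurent → (x : Fin n → Carrier) → (∀ j → IsUnit (x j)) → Carrier
  eval p x x-unit = List.foldr _+_ 0# (List.map value p)
    where
    value : Carrier × Vec ℤ n → Carrier
    value (a , e) = a * product λ j → zpow (x j) (x-unit j) (lookup e j)

------------------------------------------------------------------------
-- CNF formulas with M clauses of three literals and N variables.
-- Clause c consists of the occurrences 3c, 3c+1, 3c+2 (counted from 0),
-- which are `combine c 0F`, `combine c 1F`, `combine c 2F`.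

record CNF₃ (M N : ℕ) : Set where
  field
    var  : Fin (M ℕ.* 3) → Fin N
    sign : Fin (M ℕ.* 3) → Sign

  occurrences : Fin N → List (Fin (M ℕ.* 3))
  occurrences s = List.filter (λ a → var a Fin.≟ s) (List.allFin (M ℕ.* 3))

  field
    occurs : ∀ s → 1 ℕ.≤ List.length (occurrences s)

module LogicalFormula {c ℓ : Level} (R : CommutativeRing c ℓ)
                      (½ : CommutativeRing.Carrier R)
                      {M N : ℕ} (φ : CNF₃ M N) where
  open CommutativeRing R
  open RingOps R
  open LaurentPolynomials R (M ℕ.* 3)
  open CNF₃ φ

  ε : Fin (M ℕ.* 3) → Carrier
  ε a with sign a
  ... | Sign.+ = 1#
  ... | Sign.- = - 1#

  clauseFactor : Fin M → Laurent
  clauseFactor c = X-1 0F ⊗ X-1 1F ⊗ X-1 2F ⊕ const (fromℕ 8)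
    where
    X-1 : Fin 3 → Laurent
    X-1 p = X[ combine c p ]^ (+ 1) ⊕ const (- 1#)

  variableFactor : Fin N → Laurent
  variableFactor s = ∏ (List.map (_+1 ∘ ε/X) (occurrences s))
                   ⊕ ∏ (List.map (_+1 ∘ -ε/X) (occurrences s))
    where
    ε/X -ε/X : Fin (M ℕ.* 3) → Laurent
    ε/X  a = const (ε a) ⊗ X[ a ]^ -[1+ 0 ]
    -ε/X a = const (- ε a) ⊗ X[ a ]^ -[1+ 0 ]
    _+1 : Laurent → Laurent
    p +1 = p ⊕ const 1#

  -- 1/2^(6M-1) is written 2 (1/2)^(6M), which avoids truncated
  -- subtraction when M = 0.
  f : Laurent
  f = const (fromℕ 2 * ½ ^ (6 ℕ.* M))
    ⊗ ∏ (List.map clauseFactor (List.allFin M))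
    ⊗ ∏ (List.map variableFactor (List.allFin N))
    ⊕ const (- 1#)

IsNonZeroSignVector : ∀ {n} → Vec ℤ n → Set
IsNonZeroSignVector {n} e =
  VecAll.All (λ x → x ≡ ℤ.-1ℤ ⊎ x ≡ ℤ.0ℤ ⊎ x ≡ ℤ.1ℤ) e
  × e ≢ replicate n ℤ.0ℤ

record SignVectorEnumeration (n : ℕ) : Set where
  field
    vec       : Fin (3 ℕ.^ n ℕ.∸ 1) → Vec ℤ n
    sound     : ∀ k → IsNonZeroSignVector (vec k)
    injective : Injective _≡_ _≡_ vec
    complete  : ∀ e → IsNonZeroSignVector e → ∃ λ k → vec k ≡ e

combination : ∀ {n} → Vec ℤ n → (Fin n → ℤ) → ℤ
combination e z = List.foldr ℤ._+_ ℤ.0ℤ (List.tabulate λ j → lookup e j ℤ.* z j)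

-- Rounding may be down, up or to the nearest integer: only
-- |K aⱼ - zⱼ| < 1 is required, for one integer K common to all j.
IsIntegerization : ∀ {c ℓ₁ ℓ₂ ℓ₃} (R : RealNumbers c ℓ₁ ℓ₂ ℓ₃) {n : ℕ} →
                   (Fin n → RealNumbers.Carrier R) → (Fin n → ℤ) → Set ℓ₃
IsIntegerization R a z = ∃ λ (K : ℤ) → ∀ j →
  (∣ fromℤ K * a j - fromℤ (z j) ∣< 1#) × z j ≢ ℤ.0ℤ
  where open RealNumbers R

{-# OPTIONS --safe #-}

-- Every variable occurs in f with exponent 0 or 1 from the clauses plus 0
-- or -1 from the variable factors, so all exponent vectors of f lie in
-- {-1,0,1}ⁿ and evaluating f at Xⱼ = e^(i zⱼ θ) gives Σ qₖ e^(i z(Aₖ) θ) + C.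
-- Summing over θ = 2πm/l kills every non-constant term: the powers of an
-- l-th root of unity ω ≠ 1 add up to 0.  That e^(i z(Aₖ) 2π/l) ≠ 1 for
-- 1 ≤ |z(Aₖ)| < l comes from the minimality of π: if e^(2ix) = 1 then
-- sin x = 0.
--
-- The functional equation of exp is obtained from its partial sums Eₙ:
-- Eₙ(z) Eₙ(w) - Eₙ(z + w) is a sum of terms zⁱ wʲ / (i! j!) with
-- i, j < n ≤ i + j, and is dominated by the same sum for real x, y ≥ 0,
-- which is at most E₂ₙ(x + y) - Eₙ(x + y) and so tends to 0 because
-- exp (x + y) converges.

module Submission where

open import Defs
open import Algebra.Bundles using (CommutativeRing)
import Algebra.Properties.AbelianGroup
import Algebra.Properties.Ring
import Algebra.Properties.Semiring.Mult
import Algebra.Properties.Semiring.Sum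
import Algebra.Solver.Ring
open import Algebra.Solver.Ring.AlmostCommutativeRing
  using (fromCommutativeRing; _-Raw-AlmostCommutative⟶_)
open import Data.Empty using (⊥)
open import Data.Fin.Base using (Fin; toℕ; combine)
open import Data.Fin.Patterns using (0F; 1F; 2F)
import Data.Fin.Properties as Fin
open import Data.Integer.Base as ℤ using (ℤ; +_; -[1+_]; +[1+_]; ∣_∣)
import Data.Integer.Properties as ℤ
open import Data.List.Base as List using (List; []; _∷_)
open import Data.List.Relation.Unary.All as All using (All; []; _∷_)
import Data.List.Relation.Unary.All.Properties as All
open import Data.List.Relation.Unary.AllPairs using ([]; _∷_)
open import Data.List.Relation.Unary.Any using (Any; here; there)
open import Data.List.Relation.Unary.Unique.Propositional using (Unique)
import Data.List.Relation.Unary.Unique.Propositional.Properties as Unique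
open import Data.Maybe.Base using (Maybe; just; nothing)
open import Data.Nat.Base as ℕ using (ℕ; zero; suc; NonZero; _!)
import Data.Nat.Properties as ℕ
open import Data.Product.Base using (Σ; ∃; _×_; _,_; proj₁; proj₂)
open import Data.Sum.Base as Sum using (_⊎_; inj₁; inj₂; [_,_]′)
open import Data.Vec.Base as Vec using (Vec; lookup; replicate; _[_]≔_)
import Data.Vec.Properties as Vec
import Data.Vec.Relation.Unary.All as VecAll
import Data.Vec.Relation.Unary.All.Properties as VecAll
open import Function.Base using (_∘_; id)
open import Level using (Level; _⊔_)
open import Relation.Binary.PropositionalEquality.Core as ≡ using (_≡_; _≢_)
import Relation.Binary.PropositionalEquality.Properties as ≡
import Relation.Binary.Reasoning.Setoid
open import Relation.Binary.Structures using (IsStrictPartialOrder)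
open import Relation.Nullary.Decidable using (Dec; yes; no)
open import Relation.Nullary.Negation using (¬_; contradiction)

-- The real numbers may be constructive, so neither trichotomy nor an absolute value is at hand. A
-- non-strict inequality is the negation of `<`, sizes occur only through two-sided bounds, and
-- equalities come from tightness: for x = 0 it suffices to refute x # 0. This also explains why the
-- factor ω - 1 can be cancelled although ω = 1 is merely refuted: the conclusion is an equality,
-- which tightness makes provable by contradiction.
--
-- The exponential is given as a bare function on a setoid, described only by the limits of its
-- partial sums; that it respects equality has itself to be proved. Most facts about it rest on one
-- uniqueness principle: the terms of the series are determined by a recursion, and limits are
-- unique. The recursion also takes the place of the binomial theorem. No real exponential is
-- assumed: the real majorant converges because the complex exponential can be evaluated at a real
-- argument.

-- Commutative rings: integer multiples and a ring solver.

module CommutativeRingLemmas {c ℓ : Level} (R : CommutativeRing c ℓ) where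
  open CommutativeRing R
  open RingOps R
  open Algebra.Properties.Ring ring public
    using (-0#≈0#; -‿distribˡ-*; -‿distribʳ-*; -‿involutive)
  open Algebra.Properties.AbelianGroup +-abelianGroup using (⁻¹-∙-comm)
  open Algebra.Properties.Semiring.Mult semiring using (×-homo-+; ×1-homo-*)
  open Algebra.Properties.Semiring.Sum semiring public
    using (sum-cong-≋; sum-replicate; sum-replicate-zero; ∑-distrib-+; ∑-comm; *-distribˡ-sum)
  open Relation.Binary.Reasoning.Setoid setoid

  fromℕ-+ : ∀ m n → fromℕ (m ℕ.+ n) ≈ fromℕ m + fromℕ n
  fromℕ-+ = ×-homo-+ 1#

  fromℕ-* : ∀ m n → fromℕ (m ℕ.* n) ≈ fromℕ m * fromℕ n
  fromℕ-* = ×1-homo-*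

  -- Proved by hand, because the solver below is built on `fromℤ` being a homomorphism, and this
  -- identity is part of that proof.
  [x+y]-[x+z]≈y-z : ∀ x y z → (x + y) - (x + z) ≈ y - z
  [x+y]-[x+z]≈y-z x y z = begin
    (x + y) + - (x + z)    ≈⟨ +-cong (+-comm y x) (⁻¹-∙-comm x z) ⟨
    (y + x) + (- x + - z)  ≈⟨ +-assoc y x _ ⟩
    y + (x + (- x + - z))  ≈⟨ +-congˡ (+-assoc x (- x) (- z)) ⟨
    y + ((x - x) + - z)    ≈⟨ +-congˡ (+-congʳ (-‿inverseʳ x)) ⟩
    y + (0# + - z)         ≈⟨ +-congˡ (+-identityˡ _) ⟩
    y - z                  ∎

  fromℤ-⊖ : ∀ m n → fromℤ (m ℤ.⊖ n) ≈ fromℕ m - fromℕ n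
  fromℤ-⊖ m zero = sym (trans (+-congˡ -0#≈0#) (+-identityʳ _))
  fromℤ-⊖ zero (suc n) = sym (+-identityˡ _)
  fromℤ-⊖ (suc m) (suc n) = begin
    fromℤ (suc m ℤ.⊖ suc n)        ≡⟨ ≡.cong fromℤ (ℤ.[1+m]⊖[1+n]≡m⊖n m n) ⟩
    fromℤ (m ℤ.⊖ n)                ≈⟨ fromℤ-⊖ m n ⟩
    fromℕ m - fromℕ n              ≈⟨ [x+y]-[x+z]≈y-z 1# _ _ ⟨
    fromℕ (suc m) - fromℕ (suc n)  ∎

  fromℤ-+ : ∀ i j → fromℤ (i ℤ.+ j) ≈ fromℤ i + fromℤ j
  fromℤ-+ (+ m)    (+ n)    = fromℕ-+ m n
  fromℤ-+ (+ m)    -[1+ n ] = fromℤ-⊖ m (suc n)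
  fromℤ-+ -[1+ m ] (+ n)    = trans (fromℤ-⊖ n (suc m)) (+-comm _ _)
  fromℤ-+ -[1+ m ] -[1+ n ] = begin
    - fromℕ (suc (suc (m ℕ.+ n)))      ≡⟨ ≡.cong (λ k → - fromℕ (suc k)) (ℕ.+-suc m n) ⟨
    - fromℕ (suc m ℕ.+ suc n)          ≈⟨ -‿cong (fromℕ-+ (suc m) (suc n)) ⟩
    - (fromℕ (suc m) + fromℕ (suc n))  ≈⟨ ⁻¹-∙-comm _ _ ⟨
    - fromℕ (suc m) - fromℕ (suc n)    ∎

  fromℤ-neg : ∀ i → fromℤ (ℤ.- i) ≈ - fromℤ i
  fromℤ-neg (+ zero)  = sym -0#≈0#
  fromℤ-neg +[1+ n ]  = refl
  fromℤ-neg -[1+ n ]  = sym (-‿involutive _)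

  fromℤ-*⁺ : ∀ m j → fromℤ (+ m ℤ.* j) ≈ fromℕ m * fromℤ j
  fromℤ-*⁺ m (+ n) = trans (reflexive (≡.cong fromℤ (≡.sym (ℤ.pos-* m n)))) (fromℕ-* m n)
  fromℤ-*⁺ m -[1+ n ] = begin
    fromℤ (+ m ℤ.* ℤ.- +[1+ n ])    ≡⟨ ≡.cong fromℤ (ℤ.neg-distribʳ-* (+ m) +[1+ n ]) ⟨
    fromℤ (ℤ.- (+ m ℤ.* +[1+ n ]))  ≈⟨ fromℤ-neg (+ m ℤ.* +[1+ n ]) ⟩
    - fromℤ (+ m ℤ.* +[1+ n ])      ≈⟨ -‿cong (fromℤ-*⁺ m +[1+ n ]) ⟩
    - (fromℕ m * fromℕ (suc n))     ≈⟨ -‿distribʳ-* _ _ ⟩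
    fromℕ m * - fromℕ (suc n)       ∎

  fromℤ-* : ∀ i j → fromℤ (i ℤ.* j) ≈ fromℤ i * fromℤ j
  fromℤ-* (+ m)    j = fromℤ-*⁺ m j
  fromℤ-* -[1+ m ] j = begin
    fromℤ (ℤ.- +[1+ m ] ℤ.* j)    ≡⟨ ≡.cong fromℤ (ℤ.neg-distribˡ-* +[1+ m ] j) ⟨
    fromℤ (ℤ.- (+[1+ m ] ℤ.* j))  ≈⟨ fromℤ-neg (+[1+ m ] ℤ.* j) ⟩
    - fromℤ (+[1+ m ] ℤ.* j)      ≈⟨ -‿cong (fromℤ-*⁺ (suc m) j) ⟩
    - (fromℕ (suc m) * fromℤ j)   ≈⟨ -‿distribˡ-* _ _ ⟩
    - fromℕ (suc m) * fromℤ j     ∎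

  private
    -- Sends 1 to 1# itself rather than to 1# + 0#, so that the solver's
    -- literal `con 1` denotes 1#.
    ⟦_⟧ᶻ : ℤ → Carrier
    ⟦ + 1 ⟧ᶻ = 1#
    ⟦ i   ⟧ᶻ = fromℤ i

    ⟦⟧ᶻ≈fromℤ : ∀ i → ⟦ i ⟧ᶻ ≈ fromℤ i
    ⟦⟧ᶻ≈fromℤ (+ 0)           = refl
    ⟦⟧ᶻ≈fromℤ (+ 1)           = sym (+-identityʳ 1#)
    ⟦⟧ᶻ≈fromℤ (+ suc (suc n)) = refl
    ⟦⟧ᶻ≈fromℤ -[1+ n ]        = refl

    morphism : ℤ.+-*-rawRing -Raw-AlmostCommutative⟶ fromCommutativeRing R
    morphism = record
      { ⟦_⟧    = ⟦_⟧ᶻ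
      ; +-homo = λ i j → trans (⟦⟧ᶻ≈fromℤ (i ℤ.+ j)) (trans (fromℤ-+ i j)
                   (sym (+-cong (⟦⟧ᶻ≈fromℤ i) (⟦⟧ᶻ≈fromℤ j))))
      ; *-homo = λ i j → trans (⟦⟧ᶻ≈fromℤ (i ℤ.* j)) (trans (fromℤ-* i j)
                   (sym (*-cong (⟦⟧ᶻ≈fromℤ i) (⟦⟧ᶻ≈fromℤ j))))
      ; -‿homo = λ i → trans (⟦⟧ᶻ≈fromℤ (ℤ.- i)) (trans (fromℤ-neg i)
                   (sym (-‿cong (⟦⟧ᶻ≈fromℤ i))))
      ; 0-homo = refl
      ; 1-homo = refl
      }

    coeff≟ : ∀ i j → Maybe (⟦ i ⟧ᶻ ≈ ⟦ j ⟧ᶻ)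
    coeff≟ i j with i ℤ.≟ j
    ... | yes i≡j = just (reflexive (≡.cong ⟦_⟧ᶻ i≡j))
    ... | no  _   = nothing

  open Algebra.Solver.Ring ℤ.+-*-rawRing (fromCommutativeRing R) morphism coeff≟ public
    using (solve; _:=_; _:+_; _:*_; _:-_; :-_; con)

  x≈y⇒x-y≈0 : ∀ {x y} → x ≈ y → x - y ≈ 0#
  x≈y⇒x-y≈0 {x} {y} x≈y = trans (+-congʳ x≈y) (-‿inverseʳ y)

  x-y≈0⇒x≈y : ∀ {x y} → x - y ≈ 0# → x ≈ y
  x-y≈0⇒x≈y {x} {y} x-y≈0 = begin
    x            ≈⟨ solve 2 (λ x y → x := (x :- y) :+ y) refl x y ⟩
    (x - y) + y  ≈⟨ +-congʳ x-y≈0 ⟩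
    0# + y       ≈⟨ +-identityˡ y ⟩
    y            ∎

  -- Finite sums, Cauchy products and formal exponential series.

  Σ< : (ℕ → Carrier) → ℕ → Carrier
  Σ< f n = sum {n} (f ∘ toℕ)

  Σ<-split : ∀ f m n → Σ< f (m ℕ.+ n) ≈ Σ< f m + Σ< (f ∘ (m ℕ.+_)) n
  Σ<-split f zero    n = sym (+-identityˡ _)
  Σ<-split f (suc m) n = begin
    f 0 + Σ< (f ∘ suc) (m ℕ.+ n)  ≈⟨ +-congˡ (Σ<-split (f ∘ suc) m n) ⟩
    f 0 + (Σ< (f ∘ suc) m + Σ< (f ∘ (suc m ℕ.+_)) n)  ≈⟨ +-assoc _ _ _ ⟨
    (f 0 + Σ< (f ∘ suc) m) + Σ< (f ∘ (suc m ℕ.+_)) n  ∎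

  Σ<-cong : ∀ {f g} n → (∀ k → f k ≈ g k) → Σ< f n ≈ Σ< g n
  Σ<-cong n f≈g = sum-cong-≋ {n} (f≈g ∘ toℕ)

  -- Coefficient n of the Cauchy product. Shifting `f` while the degree drops avoids the subtraction
  -- in the index of `g`.
  conv : (f g : ℕ → Carrier) → ℕ → Carrier
  conv f g zero    = f 0 * g 0
  conv f g (suc n) = f 0 * g (suc n) + conv (f ∘ suc) g n

  -- The partial sums of the Cauchy product, summed over the triangle
  -- i + j < n row by row.
  triangle : (f g : ℕ → Carrier) → ℕ → Carrier
  triangle f g zero    = 0#
  triangle f g (suc n) = f 0 * Σ< g (suc n) + triangle (f ∘ suc) g n

  -- The sum of fᵢ gⱼ over i < n, j < n + d and i + j ≥ n.
  corner : (f g : ℕ → Carrier) → ℕ → ℕ → Carrier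
  corner f g zero    d = 0#
  corner f g (suc n) d = f 0 * Σ< (g ∘ (suc n ℕ.+_)) d + corner (f ∘ suc) g n (suc d)

  -- The left side runs through the triangle by diagonals. Removing the entry with `f 0` from each
  -- diagonal collects the first row and leaves the diagonals of the smaller triangle.
  Σ<-conv : ∀ f g n → Σ< (conv f g) n ≈ triangle f g n
  Σ<-conv f g zero    = refl
  Σ<-conv f g (suc n) = begin
    f 0 * g 0 + Σ< (λ k → f 0 * g (suc k) + conv (f ∘ suc) g k) n
      ≈⟨ +-congˡ (∑-distrib-+ {n} (λ k → f 0 * g (suc (toℕ k))) (conv (f ∘ suc) g ∘ toℕ)) ⟩
    f 0 * g 0 + (sum {n} (λ k → f 0 * g (suc (toℕ k))) + Σ< (conv (f ∘ suc) g) n)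
      ≈⟨ +-congˡ (+-cong (sym (*-distribˡ-sum {n} (f 0) (g ∘ suc ∘ toℕ))) (Σ<-conv (f ∘ suc) g n)) ⟩
    f 0 * g 0 + (f 0 * Σ< (g ∘ suc) n + triangle (f ∘ suc) g n)
      ≈⟨ +-assoc _ _ _ ⟨
    (f 0 * g 0 + f 0 * Σ< (g ∘ suc) n) + triangle (f ∘ suc) g n
      ≈⟨ +-congʳ (distribˡ (f 0) (g 0) _) ⟨
    f 0 * (g 0 + Σ< (g ∘ suc) n) + triangle (f ∘ suc) g n ∎

  -- Without the first row the triangle is one column narrower while the rectangle keeps its width,
  -- so `d` must grow in the induction; the square, d = 0, is what the estimates use.
  rectangle : ∀ f g n d → Σ< f n * Σ< g (n ℕ.+ d) ≈ triangle f g n + corner f g n d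
  rectangle f g zero    d = trans (zeroˡ _) (sym (+-identityˡ 0#))
  rectangle f g (suc n) d = begin
    (f 0 + Σ< (f ∘ suc) n) * Σ< g (suc n ℕ.+ d)
      ≈⟨ distribʳ _ _ _ ⟩
    f 0 * Σ< g (suc n ℕ.+ d) + Σ< (f ∘ suc) n * Σ< g (suc n ℕ.+ d)
      ≈⟨ +-cong (*-congˡ (Σ<-split g (suc n) d))
                (*-congˡ (reflexive (≡.cong (Σ< g) (≡.sym (ℕ.+-suc n d))))) ⟩
    f 0 * (Σ< g (suc n) + rest) + Σ< (f ∘ suc) n * Σ< g (n ℕ.+ suc d)
      ≈⟨ +-congˡ (rectangle (f ∘ suc) g n (suc d)) ⟩
    f 0 * (Σ< g (suc n) + rest) + (triangle (f ∘ suc) g n + corner (f ∘ suc) g n (suc d))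
      ≈⟨ solve 5 (λ a b c d e → a :* (b :+ c) :+ (d :+ e) := (a :* b :+ d) :+ (a :* c :+ e))
           refl (f 0) (Σ< g (suc n)) rest (triangle (f ∘ suc) g n) (corner (f ∘ suc) g n (suc d)) ⟩
    triangle f g (suc n) + corner f g (suc n) d ∎
    where rest = Σ< (g ∘ (suc n ℕ.+_)) d

  conv-cong : ∀ {f f′ g g′} → (∀ k → f k ≈ f′ k) → (∀ k → g k ≈ g′ k) →
              ∀ n → conv f g n ≈ conv f′ g′ n
  conv-cong p q zero    = *-cong (p 0) (q 0)
  conv-cong p q (suc n) = +-cong (*-cong (p 0) (q (suc n))) (conv-cong (p ∘ suc) q n)

  conv-+ˡ : ∀ f f′ g n → conv (λ k → f k + f′ k) g n ≈ conv f g n + conv f′ g n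
  conv-+ˡ f f′ g zero    = distribʳ _ _ _
  conv-+ˡ f f′ g (suc n) = trans (+-cong (distribʳ _ _ _) (conv-+ˡ (f ∘ suc) (f′ ∘ suc) g n))
    (solve 4 (λ a b c d → (a :+ b) :+ (c :+ d) := (a :+ c) :+ (b :+ d)) refl _ _ _ _)

  conv-*ˡ : ∀ x f g n → conv (λ k → x * f k) g n ≈ x * conv f g n
  conv-*ˡ x f g zero    = *-assoc _ _ _
  conv-*ˡ x f g (suc n) = trans (+-cong (*-assoc _ _ _) (conv-*ˡ x (f ∘ suc) g n))
    (sym (distribˡ _ _ _))

  -- The mirror image of the defining recursion: it removes `g 0` instead of `f 0`, which is what
  -- commutativity needs.
  conv-last : ∀ f g n → conv f g (suc n) ≈ conv f (g ∘ suc) n + f (suc n) * g 0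
  conv-last f g zero    = refl
  conv-last f g (suc n) = trans (+-congˡ (conv-last (f ∘ suc) g n)) (sym (+-assoc _ _ _))

  conv-comm : ∀ f g n → conv f g n ≈ conv g f n
  conv-comm f g zero    = *-comm _ _
  conv-comm f g (suc n) = begin
    f 0 * g (suc n) + conv (f ∘ suc) g n  ≈⟨ +-cong (*-comm _ _) (conv-comm (f ∘ suc) g n) ⟩
    g (suc n) * f 0 + conv g (f ∘ suc) n  ≈⟨ +-comm _ _ ⟩
    conv g (f ∘ suc) n + g (suc n) * f 0  ≈⟨ conv-last g f n ⟨
    conv g f (suc n)                      ∎

  -- The operator X d/dX on the coefficients of a formal power series. Unlike d/dX it shifts no
  -- index.
  deriv : (ℕ → Carrier) → ℕ → Carrier
  deriv f k = fromℕ k * f k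

  -- Leibniz' rule: the weight i + j of each product splits as i on the left factor and j on the
  -- right one.
  conv-deriv : ∀ f g n → deriv (conv f g) n ≈ conv (deriv f) g n + conv f (deriv g) n
  conv-deriv f g zero    = solve 2 (λ a b → con (+ 0) :* (a :* b) :=
    (con (+ 0) :* a) :* b :+ a :* (con (+ 0) :* b)) refl (f 0) (g 0)
  conv-deriv f g (suc n) = begin
    (1# + fromℕ n) * (f 0 * g (suc n) + conv f′ g n)
      ≈⟨ solve 4 (λ a b c d → (con (+ 1) :+ a) :* (b :* c :+ d) :=
           b :* ((con (+ 1) :+ a) :* c) :+ (d :+ a :* d)) refl (fromℕ n) (f 0) (g (suc n)) (conv f′ g n) ⟩
    f 0 * deriv g (suc n) + (conv f′ g n + deriv (conv f′ g) n)
      ≈⟨ +-congˡ (+-congˡ (conv-deriv f′ g n)) ⟩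
    f 0 * deriv g (suc n) + (conv f′ g n + (conv (deriv f′) g n + conv f′ (deriv g) n))
      ≈⟨ solve 5 (λ a b c d e → a :+ (b :+ (c :+ d)) := con (+ 0) :* e :+ (b :+ c) :+ (a :+ d))
           refl _ _ _ _ (f 0 * g (suc n)) ⟩
    -- The added zero is the entry of `deriv f` at 0, and the sum of `f′` and `deriv f′` is
    -- `deriv f` shifted by one.
    0# * (f 0 * g (suc n)) + (conv f′ g n + conv (deriv f′) g n) + (f 0 * deriv g (suc n) + conv f′ (deriv g) n)
      ≈⟨ +-congʳ (+-cong (sym (*-assoc _ _ _)) (sym (conv-+ˡ f′ (deriv f′) g n))) ⟩
    (0# * f 0) * g (suc n) + conv (λ k → f′ k + deriv f′ k) g n + conv f (deriv g) (suc n)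
      ≈⟨ +-congʳ (+-congˡ (conv-cong (λ k → solve 2 (λ a b → a :+ b :* a := (con (+ 1) :+ b) :* a)
           refl (f′ k) (fromℕ k)) (λ _ → refl) n)) ⟩
    conv (deriv f) g (suc n) + conv f (deriv g) (suc n) ∎
    where f′ = f ∘ suc

  -- For coefficients behaving like 1/k!, the sequences x^k/k! are
  -- characterised by a₀ = 1 and (k+1) a₍ₖ₊₁₎ = x aₖ; by Leibniz' rule the
  -- Cauchy product of those of x and y satisfies the recursion of x + y.
  module ExponentialSequences
    (cancel : ∀ k {x y} → fromℕ (suc k) * x ≈ fromℕ (suc k) * y → x ≈ y) where

    record IsExpSeq (x : Carrier) (a : ℕ → Carrier) : Set ℓ where
      field
        initial : a 0 ≈ 1#
        recursion : ∀ k → fromℕ (suc k) * a (suc k) ≈ x * a k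
    open IsExpSeq

    unique : ∀ {x a b} → IsExpSeq x a → IsExpSeq x b → ∀ k → a k ≈ b k
    unique p q zero    = trans (initial p) (sym (initial q))
    unique p q (suc k) = cancel k (trans (recursion p k)
      (trans (*-congˡ (unique p q k)) (sym (recursion q k))))

    private
      -- The entry of `deriv a` at 0 vanishes, and shifted by one `deriv a` is x times `a` by the
      -- recursion.
      conv-derivˡ : ∀ {x a} b → IsExpSeq x a → ∀ n → conv (deriv a) b (suc n) ≈ x * conv a b n
      conv-derivˡ {x} {a} b p n = begin
        (0# * a 0) * b (suc n) + conv (deriv a ∘ suc) b n
          ≈⟨ +-cong (trans (*-congʳ (zeroˡ _)) (zeroˡ _)) (conv-cong (recursion p) (λ _ → refl) n) ⟩
        0# + conv (λ k → x * a k) b n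
          ≈⟨ trans (+-identityˡ _) (conv-*ˡ x a b n) ⟩
        x * conv a b n ∎

    conv-isExpSeq : ∀ {x y a b} → IsExpSeq x a → IsExpSeq y b → IsExpSeq (x + y) (conv a b)
    conv-isExpSeq p q .initial = trans (*-cong (initial p) (initial q)) (*-identityˡ 1#)
    conv-isExpSeq {x} {y} {a} {b} p q .recursion k = begin
      deriv (conv a b) (suc k)
        ≈⟨ conv-deriv a b (suc k) ⟩
      conv (deriv a) b (suc k) + conv a (deriv b) (suc k)
        ≈⟨ +-cong (conv-derivˡ b p k) (trans (conv-comm a (deriv b) (suc k)) (conv-derivˡ a q k)) ⟩
      x * conv a b k + y * conv b a k
        ≈⟨ +-congˡ (*-congˡ (conv-comm b a k)) ⟩
      x * conv a b k + y * conv a b k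
        ≈⟨ distribʳ _ x y ⟨
      (x + y) * conv a b k ∎

-- Order and bounds in the real numbers.

module RealLemmas {c ℓ₁ ℓ₂ ℓ₃ : Level} (R : RealNumbers c ℓ₁ ℓ₂ ℓ₃) where
  open RealNumbers R
  open RingOps commutativeRing using (_^_)
  open IsStrictPartialOrder isStrictPartialOrder public
    using () renaming (trans to <-trans; irrefl to <-irrefl; <-respʳ-≈ to <-respʳ; <-respˡ-≈ to <-respˡ)
  open CommutativeRingLemmas commutativeRing
  open Relation.Binary.Reasoning.Setoid (CommutativeRing.setoid commutativeRing)

  -- The constructive substitute for trichotomy, inherited from cotransitivity of apartness.
  <-cotrans : ∀ {x y} → x < y → ∀ z → x < z ⊎ z < y
  <-cotrans x<y z with #-cotrans (<⇒# x<y) z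
  ... | inj₁ x#z with #⇒<⊎> x#z
  ...   | inj₁ x<z = inj₁ x<z
  ...   | inj₂ z<x = inj₂ (<-trans z<x x<y)
  <-cotrans x<y z | inj₂ z#y with #⇒<⊎> z#y
  ...   | inj₁ z<y = inj₂ z<y
  ...   | inj₂ y<z = inj₁ (<-trans x<y y<z)

  x<y⇒0<y-x : ∀ {x y} → x < y → 0# < y - x
  x<y⇒0<y-x {x} x<y = <-respˡ (-‿inverseʳ x) (+-monoˡ-< (- x) x<y)

  0<y-x⇒x<y : ∀ {x y} → 0# < y - x → x < y
  0<y-x⇒x<y {x} {y} 0<y-x = <-respˡ (+-identityˡ x)
    (<-respʳ (solve 2 (λ x y → (y :- x) :+ x := y) refl x y) (+-monoˡ-< x 0<y-x))

  -- x ≤ y is written 0≤ (y - x).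
  0≤_ : Carrier → Set ℓ₃
  0≤ x = ¬ (x < 0#)

  0≤-resp : ∀ {x y} → x ≈ y → 0≤ x → 0≤ y
  0≤-resp x≈y 0≤x y<0 = 0≤x (<-respˡ (sym x≈y) y<0)

  <⇒0≤ : ∀ {x} → 0# < x → 0≤ x
  <⇒0≤ 0<x x<0 = <-irrefl refl (<-trans 0<x x<0)

  0≤0 : 0≤ 0#
  0≤0 = <-irrefl refl

  0≤-+ : ∀ {x y} → 0≤ x → 0≤ y → 0≤ (x + y)
  0≤-+ {x} {y} 0≤x 0≤y x+y<0 with <-cotrans x+y<0 y
  ... | inj₂ y<0   = 0≤y y<0
  ... | inj₁ x+y<y = 0≤x (<-respˡ (solve 2 (λ x y → (x :+ y) :- y := x) refl x y)
                           (<-respʳ (-‿inverseʳ y) (+-monoˡ-< (- y) x+y<y)))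

  0≤-double⁻¹ : ∀ {x} → 0≤ (x + x) → 0≤ x
  0≤-double⁻¹ {x} 0≤x+x x<0 =
    0≤x+x (<-trans (<-respʳ (+-identityˡ x) (+-monoˡ-< x x<0)) x<0)

  -- Apartness from 0 is invertibility, and a factor of an invertible element is invertible.
  *#0⇒#0 : ∀ {x y} → x * y # 0# → x # 0#
  *#0⇒#0 {x} {y} xy#0 with #⇒invertible xy#0
  ... | u , u[xy]≈1 , _ = invertible⇒# (u * y , left , trans (*-comm _ _) left)
    where
    left : (u * y) * (x - 0#) ≈ 1#
    left = trans (solve 3 (λ u x y → (u :* y) :* (x :- con (+ 0)) := u :* (x :* y :- con (+ 0)))
                    refl u x y) u[xy]≈1

  0≤∧#0⇒0< : ∀ {x} → 0≤ x → x # 0# → 0# < x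
  0≤∧#0⇒0< 0≤x x#0 with #⇒<⊎> x#0
  ... | inj₁ x<0 = contradiction x<0 0≤x
  ... | inj₂ 0<x = 0<x

  -- A negative product would be apart from 0, hence so would both factors; being non-negative they
  -- would be positive, and so would the product.
  0≤-* : ∀ {x y} → 0≤ x → 0≤ y → 0≤ (x * y)
  0≤-* {x} {y} 0≤x 0≤y xy<0 = <⇒0≤ (*-pos 0<x 0<y) xy<0
    where
    0<x = 0≤∧#0⇒0< 0≤x (*#0⇒#0 (<⇒# xy<0))
    0<y = 0≤∧#0⇒0< 0≤y (*#0⇒#0 (<⇒# (<-respˡ (*-comm x y) xy<0)))

  -- As a factor of 1 the reciprocal is apart from 0, and a negative one would have a negative
  -- product with `fromℕ (suc k)`.
  0<-recip : ∀ k .{{_ : NonZero k}} → 0# < recip k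
  0<-recip (suc k) = 0≤∧#0⇒0< 0≤r (*#0⇒#0 (#-sym (<⇒# 0<r*k)))
    where
    r = recip (suc k)
    0<r*k : 0# < r * fromℕ (suc k)
    0<r*k = <-respʳ (sym (recip-inverse k)) 0<1
    0≤r : 0≤ r
    0≤r r<0 = <⇒0≤ (*-pos (<-respʳ (+-identityˡ (- r)) (x<y⇒0<y-x r<0)) (0<fromℕ k))
      (<-respˡ (-‿distribˡ-* r (fromℕ (suc k))) (0<y-x⇒x<y
        (<-respʳ (solve 1 (λ x → x := con (+ 0) :- (:- x)) refl _) 0<r*k)))

  #0-cancelˡ : ∀ {x y} → x # 0# → x * y ≈ 0# → y ≈ 0#
  #0-cancelˡ {x} {y} x#0 xy≈0 with #⇒invertible x#0
  ... | u , u[x-0]≈1 , _ = begin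
    y                      ≈⟨ *-identityˡ y ⟨
    1# * y                 ≈⟨ *-congʳ u[x-0]≈1 ⟨
    (u * (x - 0#)) * y     ≈⟨ solve 3 (λ u x y → (u :* (x :- con (+ 0))) :* y := u :* (x :* y))
                                refl u x y ⟩
    u * (x * y)            ≈⟨ *-congˡ xy≈0 ⟩
    u * 0#                 ≈⟨ zeroʳ u ⟩
    0#                     ∎

  0<-square : ∀ {x} → x # 0# → 0# < x * x
  0<-square {x} x#0 with #⇒<⊎> x#0
  ... | inj₂ 0<x = *-pos 0<x 0<x
  ... | inj₁ x<0 = <-respʳ (solve 1 (λ x → (con (+ 0) :- x) :* (con (+ 0) :- x) := x :* x) refl x)
                     (*-pos (x<y⇒0<y-x x<0) (x<y⇒0<y-x x<0))

  0≤-square : ∀ x → 0≤ (x * x)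
  0≤-square x xx<0 = <⇒0≤ (0<-square (*#0⇒#0 (<⇒# xx<0))) xx<0

  0<-+ : ∀ {x y} → 0# < x → 0≤ y → 0# < x + y
  0<-+ {x} {y} 0<x 0≤y with <-cotrans 0<x (x + y)
  ... | inj₁ 0<x+y = 0<x+y
  ... | inj₂ x+y<x = contradiction
    (<-respˡ (solve 2 (λ x y → (x :+ y) :- x := y) refl x y)
      (<-respʳ (-‿inverseʳ x) (+-monoˡ-< (- x) x+y<x))) 0≤y

  infix 4 ∣_∣≤_
  -- The two inequalities x ≤ a and -x ≤ a stand in for an absolute value.
  record ∣_∣≤_ (x a : Carrier) : Set ℓ₃ where
    constructor _,_
    field
      upper : 0≤ (a - x)
      lower : 0≤ (a + x)
  open ∣_∣≤_

  ∣∣<⇒∣∣≤ : ∀ {x a} → ∣ x ∣< a → ∣ x ∣≤ a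
  ∣∣<⇒∣∣≤ {x} {a} (-a<x , x<a) = <⇒0≤ (x<y⇒0<y-x x<a)
    , 0≤-resp (solve 2 (λ x a → x :- (:- a) := a :+ x) refl x a) (<⇒0≤ (x<y⇒0<y-x -a<x))

  ∣∣≤-resp : ∀ {x y a b} → x ≈ y → a ≈ b → ∣ x ∣≤ a → ∣ y ∣≤ b
  ∣∣≤-resp x≈y a≈b (p , q) =
    0≤-resp (+-cong a≈b (-‿cong x≈y)) p , 0≤-resp (+-cong a≈b x≈y) q

  ∣∣≤-refl : ∀ {x} → 0≤ x → ∣ x ∣≤ x
  ∣∣≤-refl {x} 0≤x = 0≤-resp (sym (-‿inverseʳ x)) 0≤0 , 0≤-+ 0≤x 0≤x

  ∣∣≤⇒0≤ : ∀ {x a} → ∣ x ∣≤ a → 0≤ a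
  ∣∣≤⇒0≤ {x} {a} (p , q) = 0≤-double⁻¹
    (0≤-resp (solve 2 (λ x a → (a :- x) :+ (a :+ x) := a :+ a) refl x a) (0≤-+ p q))

  ∣∣≤-mono : ∀ {x a b} → 0≤ (b - a) → ∣ x ∣≤ a → ∣ x ∣≤ b
  ∣∣≤-mono {x} {a} {b} a≤b (p , q) =
    0≤-resp (solve 3 (λ x a b → (b :- a) :+ (a :- x) := b :- x) refl x a b) (0≤-+ a≤b p) ,
    0≤-resp (solve 3 (λ x a b → (b :- a) :+ (a :+ x) := b :+ x) refl x a b) (0≤-+ a≤b q)

  ∣∣≤-neg : ∀ {x a} → ∣ x ∣≤ a → ∣ - x ∣≤ a
  ∣∣≤-neg {x} {a} (p , q) = 0≤-resp (+-congˡ (sym (-‿involutive x))) q , p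

  ∣∣≤-+ : ∀ {x y a b} → ∣ x ∣≤ a → ∣ y ∣≤ b → ∣ x + y ∣≤ a + b
  ∣∣≤-+ {x} {y} {a} {b} (p , q) (p′ , q′) =
    0≤-resp (solve 4 (λ x y a b → (a :- x) :+ (b :- y) := (a :+ b) :- (x :+ y)) refl x y a b) (0≤-+ p p′) ,
    0≤-resp (solve 4 (λ x y a b → (a :+ x) :+ (b :+ y) := (a :+ b) :+ (x :+ y)) refl x y a b) (0≤-+ q q′)

  -- 2 (ab ∓ xy) = (a ∓ x)(b + y) + (a ± x)(b - y)
  ∣∣≤-* : ∀ {x y a b} → ∣ x ∣≤ a → ∣ y ∣≤ b → ∣ x * y ∣≤ a * b
  ∣∣≤-* {x} {y} {a} {b} (p , q) (p′ , q′) =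
    0≤-double⁻¹ (0≤-resp (solve 4 (λ x y a b → (a :- x) :* (b :+ y) :+ (a :+ x) :* (b :- y)
      := (a :* b :- x :* y) :+ (a :* b :- x :* y)) refl x y a b) (0≤-+ (0≤-* p q′) (0≤-* q p′))) ,
    0≤-double⁻¹ (0≤-resp (solve 4 (λ x y a b → (a :+ x) :* (b :+ y) :+ (a :- x) :* (b :- y)
      := (a :* b :+ x :* y) :+ (a :* b :+ x :* y)) refl x y a b) (0≤-+ (0≤-* q q′) (0≤-* p p′)))

  0≤fromℕ : ∀ k → 0≤ fromℕ k
  0≤fromℕ zero    = 0≤0
  0≤fromℕ (suc k) = <⇒0≤ (0<fromℕ k)

  -- Adding the Archimedean bounds of x and -x avoids a maximum; the successor makes the bound
  -- positive, so that an ε can be divided by it.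
  ∣∣-bounded : ∀ x → ∃ λ k → ∣ x ∣≤ fromℕ (suc k)
  ∣∣-bounded x with archimedean x | archimedean (- x)
  ... | k , x<k | k′ , -x<k′ = k ℕ.+ k′ , bounded
    where
    bound : ∀ y → 0≤ (fromℕ k + fromℕ k′ - y) → 0≤ (fromℕ (suc (k ℕ.+ k′)) - y)
    bound y 0≤z = 0≤-resp (trans (sym (+-assoc _ _ _)) (+-congʳ (+-congˡ (sym (fromℕ-+ k k′)))))
      (0≤-+ (<⇒0≤ 0<1) 0≤z)
    bounded : ∣ x ∣≤ fromℕ (suc (k ℕ.+ k′))
    bounded =
      bound x (0≤-resp (solve 3 (λ a b x → (a :- x) :+ b := (a :+ b) :- x) refl _ _ x)
        (0≤-+ (<⇒0≤ (x<y⇒0<y-x x<k)) (0≤fromℕ k′))) ,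
      0≤-resp (+-congˡ (-‿involutive x))
        (bound (- x) (0≤-resp (solve 3 (λ a b x → a :+ (b :- x) := (a :+ b) :- x) refl _ _ (- x))
          (0≤-+ (0≤fromℕ k) (<⇒0≤ (x<y⇒0<y-x -x<k′)))))

  -- Real sequences tending to 0.

  IsNull : (ℕ → Carrier) → Set (c ⊔ ℓ₃)
  IsNull u = ∀ ε → 0# < ε → ∃ λ K → ∀ p → K ℕ.≤ p → ∣ u p ∣≤ ε

  abstract
    divide : ∀ k {ε} → 0# < ε → ∃ λ δ → 0# < δ × fromℕ (suc k) * δ ≈ ε
    divide k {ε} 0<ε = recip (suc k) * ε , *-pos (0<-recip (suc k)) 0<ε ,
      trans (solve 3 (λ n r x → n :* (r :* x) := (r :* n) :* x) refl _ _ ε)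
        (trans (*-congʳ (recip-inverse k)) (*-identityˡ ε))

  halve : ∀ {ε} → 0# < ε → ∃ λ δ → 0# < δ × δ + δ ≈ ε
  halve 0<ε with divide 1 0<ε
  ... | δ , 0<δ , 2δ≈ε = δ , 0<δ , trans
    (solve 1 (λ x → x :+ x := (con (+ 1) :+ (con (+ 1) :+ con (+ 0))) :* x) refl δ) 2δ≈ε

  ⟶⇒null : ∀ {s x} → s ⟶ x → IsNull (λ p → s p - x)
  ⟶⇒null s⟶x ε 0<ε with s⟶x ε 0<ε
  ... | K , close = K , λ p K≤p → ∣∣<⇒∣∣≤ (close p K≤p)

  null-dominated : ∀ {u v} → (∀ p → ∣ u p ∣≤ v p) → IsNull v → IsNull u
  null-dominated {u} {v} u≤v v-null ε 0<ε with v-null ε 0<ε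
  ... | K , small = K , λ p K≤p → ∣∣≤-mono (upper (small p K≤p)) (u≤v p)

  null-resp : ∀ {u v} → (∀ p → u p ≈ v p) → IsNull u → IsNull v
  null-resp u≈v u-null ε 0<ε with u-null ε 0<ε
  ... | K , small = K , λ p K≤p → ∣∣≤-resp (u≈v p) refl (small p K≤p)

  null-neg : ∀ {u} → IsNull u → IsNull (λ p → - u p)
  null-neg u-null ε 0<ε with u-null ε 0<ε
  ... | K , small = K , λ p K≤p → ∣∣≤-neg (small p K≤p)

  null-subsequence : ∀ {u} (g : ℕ → ℕ) → (∀ p → p ℕ.≤ g p) → IsNull u → IsNull (u ∘ g)
  null-subsequence g p≤gp u-null ε 0<ε with u-null ε 0<ε
  ... | K , small = K , λ p K≤p → small (g p) (ℕ.≤-trans K≤p (p≤gp p))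

  null-+ : ∀ {u v} → IsNull u → IsNull v → IsNull (λ p → u p + v p)
  null-+ u-null v-null ε 0<ε with halve 0<ε
  ... | δ , 0<δ , δ+δ≈ε with u-null δ 0<δ | v-null δ 0<δ
  ... | K , small | K′ , small′ = K ℕ.⊔ K′ , λ p K≤p → ∣∣≤-resp refl δ+δ≈ε
    (∣∣≤-+ (small p (ℕ.m⊔n≤o⇒m≤o K K′ K≤p)) (small′ p (ℕ.m⊔n≤o⇒n≤o K K′ K≤p)))

  null-*ˡ : ∀ x {u} → IsNull u → IsNull (λ p → x * u p)
  null-*ˡ x u-null ε 0<ε with ∣∣-bounded x
  ... | k , x≤k with divide k 0<ε
  ... | δ , 0<δ , kδ≈ε with u-null δ 0<δ
  ... | K , small = K , λ p K≤p → ∣∣≤-resp refl kδ≈ε (∣∣≤-* x≤k (small p K≤p))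

  null-* : ∀ {u v} → IsNull u → IsNull v → IsNull (λ p → u p * v p)
  null-* u-null v-null ε 0<ε with u-null ε 0<ε | v-null 1# 0<1
  ... | K , small | K′ , small′ = K ℕ.⊔ K′ , λ p K≤p → ∣∣≤-resp refl (*-identityʳ ε)
    (∣∣≤-* (small p (ℕ.m⊔n≤o⇒m≤o K K′ K≤p)) (small′ p (ℕ.m⊔n≤o⇒n≤o K K′ K≤p)))

  -- By tightness it suffices to exclude x > 0 and x < 0. A positive constant would be bounded by
  -- its own half.
  null-const : ∀ {x} → IsNull (λ _ → x) → x ≈ 0#
  null-const {x} x-null = proj₁ (tight x 0#) λ x#0 → apart (#⇒<⊎> x#0)
    where
    not-positive : ∀ {y} → (∀ ε → 0# < ε → ∣ y ∣≤ ε) → ¬ (0# < y)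
    not-positive {y} small 0<y with halve 0<y
    ... | δ , 0<δ , δ+δ≈y = 0≤-resp (trans (+-congˡ (-‿cong (sym δ+δ≈y)))
        (solve 1 (λ h → h :- (h :+ h) := con (+ 0) :- h) refl δ)) (upper (small δ 0<δ))
      (0<y-x⇒x<y (<-respʳ (solve 1 (λ h → h := con (+ 0) :- (con (+ 0) :- h)) refl δ) 0<δ))
    apart : ¬ (x < 0# ⊎ 0# < x)
    apart (inj₂ 0<x) = not-positive (λ ε 0<ε → proj₂ (x-null ε 0<ε) _ ℕ.≤-refl) 0<x
    apart (inj₁ x<0) = not-positive (λ ε 0<ε → ∣∣≤-neg (proj₂ (x-null ε 0<ε) _ ℕ.≤-refl))
      (<-respʳ (+-identityˡ (- x)) (x<y⇒0<y-x x<0))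

  fromℕ-cancelˡ : ∀ k {x y} → fromℕ (suc k) * x ≈ fromℕ (suc k) * y → x ≈ y
  fromℕ-cancelˡ k {x} {y} kx≈ky = x-y≈0⇒x≈y (#0-cancelˡ (#-sym (<⇒# (0<fromℕ k)))
    (trans (solve 3 (λ n x y → n :* (x :- y) := n :* x :- n :* y) refl _ x y)
      (x≈y⇒x-y≈0 kx≈ky)))

  -- The real exponential series.

  open ExponentialSequences fromℕ-cancelˡ public
  open IsExpSeq

  recip! : ℕ → Carrier
  recip! k = recip (k !) {{k ℕ.!≢0}}

  recip-inverseˡ : ∀ k .{{_ : NonZero k}} → recip k * fromℕ k ≈ 1#
  recip-inverseˡ (suc k) = recip-inverse k

  recip!-zero : recip! 0 ≈ 1#
  recip!-zero = trans (sym (trans (*-congˡ (+-identityʳ _)) (*-identityʳ _))) (recip-inverse 0)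

  recip!-suc : ∀ k → fromℕ (suc k) * recip! (suc k) ≈ recip! k
  recip!-suc k = begin
    n * x                      ≈⟨ *-identityˡ _ ⟨
    1# * (n * x)               ≈⟨ *-congʳ (recip-inverseˡ (k !) {{k ℕ.!≢0}}) ⟨
    (y * m) * (n * x)          ≈⟨ solve 4 (λ n m x y → (y :* m) :* (n :* x) := y :* (x :* (n :* m)))
                                    refl n m x y ⟩
    y * (x * (n * m))          ≈⟨ *-congˡ (*-congˡ (fromℕ-* (suc k) (k !))) ⟨
    y * (x * fromℕ (suc k !))  ≈⟨ *-congˡ (recip-inverseˡ (suc k !) {{suc k ℕ.!≢0}}) ⟩
    y * 1#                     ≈⟨ *-identityʳ y ⟩
    y                          ∎
    where
    n = fromℕ (suc k)
    m = fromℕ (k !)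
    x = recip! (suc k)
    y = recip! k

  0≤recip! : ∀ k → 0≤ recip! k
  0≤recip! k = <⇒0≤ (0<-recip (k !) {{k ℕ.!≢0}})

  expTerm : Carrier → ℕ → Carrier
  expTerm x k = (x ^ k) * recip! k

  expTerm-isExpSeq : ∀ x → IsExpSeq x (expTerm x)
  expTerm-isExpSeq x .initial     = trans (*-identityˡ _) recip!-zero
  expTerm-isExpSeq x .recursion k = trans
    (solve 4 (λ n x p r → n :* ((x :* p) :* r) := x :* (p :* (n :* r))) refl _ x (x ^ k) _)
    (*-congˡ (*-congˡ (recip!-suc k)))

  0≤-Σ< : ∀ {F} → (∀ k → 0≤ F k) → ∀ n → 0≤ Σ< F n
  0≤-Σ< 0≤F zero    = 0≤0
  0≤-Σ< 0≤F (suc n) = 0≤-+ (0≤F 0) (0≤-Σ< (0≤F ∘ suc) n)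

  Σ<-mono : ∀ {F} → (∀ k → 0≤ F k) → ∀ m n → 0≤ (Σ< F (m ℕ.+ n) - Σ< F m)
  Σ<-mono {F} 0≤F m n = 0≤-resp
    (trans (solve 2 (λ a b → b := (a :+ b) :- a) refl (Σ< F m) _) (+-congʳ (sym (Σ<-split F m n))))
    (0≤-Σ< (0≤F ∘ (m ℕ.+_)) n)

  0≤-triangle : ∀ {F G} → (∀ k → 0≤ F k) → (∀ k → 0≤ G k) → ∀ n → 0≤ triangle F G n
  0≤-triangle 0≤F 0≤G zero    = 0≤0
  0≤-triangle 0≤F 0≤G (suc n) =
    0≤-+ (0≤-* (0≤F 0) (0≤-Σ< 0≤G (suc n))) (0≤-triangle (0≤F ∘ suc) 0≤G n)

  -- From i < m and j < n follows i + j < m + n, so the rectangle lies inside the triangle; all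
  -- terms are non-negative.
  rectangle≤triangle : ∀ {F G} → (∀ k → 0≤ F k) → (∀ k → 0≤ G k) → ∀ m n →
                       0≤ (triangle F G (m ℕ.+ n) - Σ< F m * Σ< G n)
  rectangle≤triangle 0≤F 0≤G zero n = 0≤-resp
    (solve 2 (λ t s → t := t :- con (+ 0) :* s) refl _ _) (0≤-triangle 0≤F 0≤G n)
  rectangle≤triangle {F} {G} 0≤F 0≤G (suc m) n = 0≤-resp
    (solve 5 (λ f s t u v → f :* (s :- t) :+ (u :- v :* t) := (f :* s :+ u) :- (f :+ v) :* t)
      refl (F 0) (Σ< G (suc m ℕ.+ n)) (Σ< G n) _ _)
    (0≤-+ (0≤-* (0≤F 0) (0≤-resp (+-congʳ (reflexive (≡.cong (Σ< G) (ℕ.+-comm n (suc m)))))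
        (Σ<-mono 0≤G n (suc m))))
      (rectangle≤triangle (0≤F ∘ suc) 0≤G m n))

  -- The diagonals of the triangle are the terms of the series of x + y, because they satisfy its
  -- recursion.
  triangle-expTerm : ∀ x y n → triangle (expTerm x) (expTerm y) n ≈ Σ< (expTerm (x + y)) n
  triangle-expTerm x y n = trans (sym (Σ<-conv (expTerm x) (expTerm y) n)) (Σ<-cong n (unique
    (conv-isExpSeq (expTerm-isExpSeq x) (expTerm-isExpSeq y)) (expTerm-isExpSeq (x + y))))

  -- The square of side n is the triangle of size n together with the corner, and it fits into the
  -- triangle of size 2n. So the corner is at most the difference of the two triangles.
  corner-bound : ∀ {x y} → (∀ k → 0≤ expTerm x k) → (∀ k → 0≤ expTerm y k) → ∀ n →
    0≤ (Σ< (expTerm (x + y)) (n ℕ.+ n) - Σ< (expTerm (x + y)) n - corner (expTerm x) (expTerm y) n 0)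
  corner-bound {x} {y} 0≤F 0≤G n = 0≤-resp (begin
    triangle F G (n ℕ.+ n) - Σ< F n * Σ< G n
      ≡⟨ ≡.cong (λ k → triangle F G (n ℕ.+ n) - Σ< F n * Σ< G k) (ℕ.+-identityʳ n) ⟨
    triangle F G (n ℕ.+ n) - Σ< F n * Σ< G (n ℕ.+ 0)
      ≈⟨ +-congˡ (-‿cong (rectangle F G n 0)) ⟩
    triangle F G (n ℕ.+ n) - (triangle F G n + corner F G n 0)
      ≈⟨ solve 3 (λ p q b → p :- (q :+ b) := p :- q :- b) refl _ _ _ ⟩
    triangle F G (n ℕ.+ n) - triangle F G n - corner F G n 0
      ≈⟨ +-congʳ (+-cong (triangle-expTerm x y (n ℕ.+ n)) (-‿cong (triangle-expTerm x y n))) ⟩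
    Σ< H (n ℕ.+ n) - Σ< H n - corner F G n 0 ∎)
    (rectangle≤triangle 0≤F 0≤G n n)
    where
    F = expTerm x
    G = expTerm y
    H = expTerm (x + y)

-- Complex conjugation, null sequences and a norm bound.

module ComplexLemmas {c ℓ₁ ℓ₂ ℓ₃ : Level} (R : RealNumbers c ℓ₁ ℓ₂ ℓ₃) where
  private
    module ℝ where
      open RealNumbers R public
      open RingOps commutativeRing public using (_^_)
      open RealLemmas R public
      open CommutativeRingLemmas commutativeRing public
  open ComplexNumbers R
  open CommutativeRing ℂ-ring
  open RingOps ℂ-ring
  open CommutativeRingLemmas ℂ-ring
  open ℝ using () renaming
    (_:+_ to _:+ᴿ_; _:*_ to _:*ᴿ_; _:-_ to _:-ᴿ_; :-_ to :-ᴿ_; _:=_ to _:=ᴿ_; con to conᴿ)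
  open Relation.Binary.Reasoning.Setoid setoid

  conj : ℂ → ℂ
  conj (a +i b) = a +i (ℝ.- b)

  conj-cong : ∀ {z w} → z ≈ w → conj z ≈ conj w
  conj-cong (p , q) = p , ℝ.-‿cong q

  conj-+ : ∀ z w → conj (z + w) ≈ conj z + conj w
  conj-+ (a +i b) (c +i d) =
    ℝ.refl , ℝ.solve 2 (λ b d → :-ᴿ (b :+ᴿ d) :=ᴿ :-ᴿ b :+ᴿ :-ᴿ d) ℝ.refl b d

  conj-* : ∀ z w → conj (z * w) ≈ conj z * conj w
  conj-* (a +i b) (c +i d) =
    ℝ.solve 4 (λ a b c d → a :*ᴿ c :-ᴿ b :*ᴿ d :=ᴿ a :*ᴿ c :-ᴿ (:-ᴿ b) :*ᴿ (:-ᴿ d)) ℝ.refl a b c d ,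
    ℝ.solve 4 (λ a b c d → :-ᴿ (a :*ᴿ d :+ᴿ b :*ᴿ c) :=ᴿ a :*ᴿ (:-ᴿ d) :+ᴿ (:-ᴿ b) :*ᴿ c) ℝ.refl a b c d

  conj-ofReal : ∀ x → conj (ofReal x) ≈ ofReal x
  conj-ofReal x = ℝ.refl , ℝ.-0#≈0#

  ofReal-cong : ∀ {x y} → x ℝ.≈ y → ofReal x ≈ ofReal y
  ofReal-cong x≈y = x≈y , ℝ.refl

  ofReal-+ : ∀ x y → ofReal (x ℝ.+ y) ≈ ofReal x + ofReal y
  ofReal-+ x y = ℝ.refl , ℝ.sym (ℝ.+-identityˡ ℝ.0#)

  ofReal-* : ∀ x y → ofReal (x ℝ.* y) ≈ ofReal x * ofReal y
  ofReal-* x y =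
    ℝ.solve 2 (λ x y → x :*ᴿ y :=ᴿ x :*ᴿ y :-ᴿ conᴿ (+ 0) :*ᴿ conᴿ (+ 0)) ℝ.refl x y ,
    ℝ.solve 2 (λ x y → conᴿ (+ 0) :=ᴿ x :*ᴿ conᴿ (+ 0) :+ᴿ conᴿ (+ 0) :*ᴿ y) ℝ.refl x y

  ofReal-fromℕ : ∀ k → ofReal (ℝ.fromℕ k) ≈ fromℕ k
  ofReal-fromℕ zero    = refl
  ofReal-fromℕ (suc k) = trans (ofReal-+ ℝ.1# (ℝ.fromℕ k)) (+-congˡ (ofReal-fromℕ k))

  conj-fromℕ : ∀ k → conj (fromℕ k) ≈ fromℕ k
  conj-fromℕ k = trans (conj-cong (sym (ofReal-fromℕ k))) (trans (conj-ofReal _) (ofReal-fromℕ k))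

  ofReal-Σ< : ∀ f n → ofReal (ℝ.Σ< f n) ≈ Σ< (ofReal ∘ f) n
  ofReal-Σ< f zero    = refl
  ofReal-Σ< f (suc n) = trans (ofReal-+ _ _) (+-congˡ (ofReal-Σ< (f ∘ suc) n))

  conj-Σ< : ∀ f n → conj (Σ< f n) ≈ Σ< (conj ∘ f) n
  conj-Σ< f zero    = conj-ofReal ℝ.0#
  conj-Σ< f (suc n) = trans (conj-+ _ _) (+-congˡ (conj-Σ< (f ∘ suc) n))

  -- w * conj w is a non-zero real when w is apart from 0; tightness of
  -- the apartness does the rest.
  *≈0⇒≈0 : ∀ {z w} → z * w ≈ 0# → ¬ z ≈ 0# → w ≈ 0#
  *≈0⇒≈0 {z@(a +i b)} {w@(c +i d)} (ac-bd≈0 , ad+bc≈0) z≉0 =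
    proj₁ (ℝ.tight c ℝ.0#) (λ c#0 → norm≮ (ℝ.0<-+ (ℝ.0<-square c#0) (ℝ.0≤-square d))) ,
    proj₁ (ℝ.tight d ℝ.0#) (λ d#0 → norm≮ (ℝ.<-respʳ (ℝ.+-comm _ _)
      (ℝ.0<-+ (ℝ.0<-square d#0) (ℝ.0≤-square c))))
    where
    norm : ℝ.Carrier
    norm = c ℝ.* c ℝ.+ d ℝ.* d
    combine≈0 : ∀ {x y} u v → x ℝ.≈ ℝ.0# → y ℝ.≈ ℝ.0# → x ℝ.* u ℝ.+ y ℝ.* v ℝ.≈ ℝ.0#
    combine≈0 u v p q = ℝ.trans (ℝ.+-cong (ℝ.*-congʳ p) (ℝ.*-congʳ q))
      (ℝ.solve 2 (λ u v → conᴿ (+ 0) :*ᴿ u :+ᴿ conᴿ (+ 0) :*ᴿ v :=ᴿ conᴿ (+ 0)) ℝ.refl u v)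
    norm≮ : ¬ (ℝ.0# ℝ.< norm)
    -- The two components of norm * z = (z * w) * conj w, whose right side vanishes with z * w;
    -- cancelling the norm would give z = 0.
    norm≮ 0<norm = z≉0
      ( ℝ.#0-cancelˡ norm#0 (ℝ.trans
          (ℝ.solve 4 (λ a b c d → (c :*ᴿ c :+ᴿ d :*ᴿ d) :*ᴿ a :=ᴿ
            (a :*ᴿ c :-ᴿ b :*ᴿ d) :*ᴿ c :+ᴿ (a :*ᴿ d :+ᴿ b :*ᴿ c) :*ᴿ d) ℝ.refl a b c d)
          (combine≈0 c d ac-bd≈0 ad+bc≈0))
      , ℝ.#0-cancelˡ norm#0 (ℝ.trans
          (ℝ.solve 4 (λ a b c d → (c :*ᴿ c :+ᴿ d :*ᴿ d) :*ᴿ b :=ᴿ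
            (a :*ᴿ c :-ᴿ b :*ᴿ d) :*ᴿ (conᴿ (+ 0) :-ᴿ d) :+ᴿ (a :*ᴿ d :+ᴿ b :*ᴿ c) :*ᴿ c) ℝ.refl a b c d)
          (combine≈0 (ℝ.0# ℝ.- d) c ac-bd≈0 ad+bc≈0)))
      where norm#0 = ℝ.#-sym (ℝ.<⇒# 0<norm)

  record IsNullᶜ (u : ℕ → ℂ) : Set (c ⊔ ℓ₃) where
    constructor _,_
    field
      re-null : ℝ.IsNull (re ∘ u)
      im-null : ℝ.IsNull (im ∘ u)
  open IsNullᶜ public

  nullᶜ-resp : ∀ {u v} → (∀ p → u p ≈ v p) → IsNullᶜ u → IsNullᶜ v
  nullᶜ-resp u≈v (p , q) = ℝ.null-resp (re≈ ∘ u≈v) p , ℝ.null-resp (im≈ ∘ u≈v) q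

  nullᶜ-+ : ∀ {u v} → IsNullᶜ u → IsNullᶜ v → IsNullᶜ (λ p → u p + v p)
  nullᶜ-+ (p , q) (p′ , q′) = ℝ.null-+ p p′ , ℝ.null-+ q q′

  nullᶜ-neg : ∀ {u} → IsNullᶜ u → IsNullᶜ (λ p → - u p)
  nullᶜ-neg (p , q) = ℝ.null-neg p , ℝ.null-neg q

  nullᶜ-conj : ∀ {u} → IsNullᶜ u → IsNullᶜ (conj ∘ u)
  nullᶜ-conj (p , q) = p , ℝ.null-neg q

  nullᶜ-* : ∀ {u v} → IsNullᶜ u → IsNullᶜ v → IsNullᶜ (λ p → u p * v p)
  nullᶜ-* (p , q) (p′ , q′) =
    ℝ.null-+ (ℝ.null-* p p′) (ℝ.null-neg (ℝ.null-* q q′)) ,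
    ℝ.null-+ (ℝ.null-* p q′) (ℝ.null-* q p′)

  nullᶜ-*ˡ : ∀ z {u} → IsNullᶜ u → IsNullᶜ (λ p → z * u p)
  nullᶜ-*ˡ (a +i b) (p , q) =
    ℝ.null-+ (ℝ.null-*ˡ a p) (ℝ.null-neg (ℝ.null-*ˡ b q)) ,
    ℝ.null-+ (ℝ.null-*ˡ a q) (ℝ.null-*ˡ b p)

  nullᶜ-subsequence : ∀ {u} (g : ℕ → ℕ) → (∀ p → p ℕ.≤ g p) → IsNullᶜ u → IsNullᶜ (u ∘ g)
  nullᶜ-subsequence {u} g p≤gp (p , q) =
    ℝ.null-subsequence {re ∘ u} g p≤gp p , ℝ.null-subsequence {im ∘ u} g p≤gp q

  nullᶜ-const : ∀ {z} → IsNullᶜ (λ _ → z) → z ≈ 0#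
  nullᶜ-const (p , q) = ℝ.null-const p , ℝ.null-const q

  null-products : ∀ {u v : ℕ → ℂ} {z w} → IsNullᶜ (λ p → u p - z) → IsNullᶜ (λ p → v p - w) →
                  IsNullᶜ (λ p → u p * v p - z * w)
  null-products {u} {v} {z} {w} u-z v-w = nullᶜ-resp
    (λ p → solve 4 (λ u v z w → ((u :- z) :* (v :- w) :+ z :* (v :- w)) :+ w :* (u :- z)
       := u :* v :- z :* w) refl (u p) (v p) z w)
    (nullᶜ-+ (nullᶜ-+ (nullᶜ-* u-z v-w) (nullᶜ-*ˡ z v-w)) (nullᶜ-*ˡ w u-z))

  -- |re z| + |im z| ≤ a; this norm, unlike the maximum norm, is
  -- submultiplicative.
  infix 4 _≪_
  record _≪_ (z : ℂ) (a : ℝ.Carrier) : Set (c ⊔ ℓ₁ ⊔ ℓ₃) where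
    field
      {reBound imBound} : ℝ.Carrier
      re≤   : ℝ.∣ re z ∣≤ reBound
      im≤   : ℝ.∣ im z ∣≤ imBound
      split : reBound ℝ.+ imBound ℝ.≈ a
  open _≪_

  ∣re∣≤ : ∀ {z a} → z ≪ a → ℝ.∣ re z ∣≤ a
  ∣re∣≤ p = ℝ.∣∣≤-mono (ℝ.0≤-resp (ℝ.trans
    (ℝ.solve 2 (λ x y → y :=ᴿ (x :+ᴿ y) :-ᴿ x) ℝ.refl _ _) (ℝ.+-congʳ (split p)))
    (ℝ.∣∣≤⇒0≤ (im≤ p))) (re≤ p)

  ∣im∣≤ : ∀ {z a} → z ≪ a → ℝ.∣ im z ∣≤ a
  ∣im∣≤ p = ℝ.∣∣≤-mono (ℝ.0≤-resp (ℝ.trans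
    (ℝ.solve 2 (λ x y → x :=ᴿ (x :+ᴿ y) :-ᴿ y) ℝ.refl _ _) (ℝ.+-congʳ (split p)))
    (ℝ.∣∣≤⇒0≤ (re≤ p))) (im≤ p)

  ≪-ofReal : ∀ {x} → ℝ.0≤ x → ofReal x ≪ x
  ≪-ofReal {x} 0≤x = record
    { re≤ = ℝ.∣∣≤-refl 0≤x ; im≤ = ℝ.∣∣≤-refl ℝ.0≤0 ; split = ℝ.+-identityʳ x }

  ≪-+ : ∀ {z w a b} → z ≪ a → w ≪ b → z + w ≪ a ℝ.+ b
  ≪-+ p q = record
    { re≤ = ℝ.∣∣≤-+ (re≤ p) (re≤ q)
    ; im≤ = ℝ.∣∣≤-+ (im≤ p) (im≤ q)
    ; split = ℝ.trans (ℝ.solve 4 (λ a b c d → (a :+ᴿ c) :+ᴿ (b :+ᴿ d) :=ᴿ (a :+ᴿ b) :+ᴿ (c :+ᴿ d))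
        ℝ.refl _ _ _ _) (ℝ.+-cong (split p) (split q))
    }

  ≪-* : ∀ {z w a b} → z ≪ a → w ≪ b → z * w ≪ a ℝ.* b
  ≪-* p q = record
    { re≤ = ℝ.∣∣≤-+ (ℝ.∣∣≤-* (re≤ p) (re≤ q)) (ℝ.∣∣≤-neg (ℝ.∣∣≤-* (im≤ p) (im≤ q)))
    ; im≤ = ℝ.∣∣≤-+ (ℝ.∣∣≤-* (re≤ p) (im≤ q)) (ℝ.∣∣≤-* (im≤ p) (re≤ q))
    ; split = ℝ.trans (ℝ.solve 4 (λ a b c d →
        (a :*ᴿ c :+ᴿ b :*ᴿ d) :+ᴿ (a :*ᴿ d :+ᴿ b :*ᴿ c) :=ᴿ (a :+ᴿ b) :*ᴿ (c :+ᴿ d))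
        ℝ.refl _ _ _ _) (ℝ.*-cong (split p) (split q))
    }

  ≪-^ : ∀ {z a} → z ≪ a → ∀ k → z ^ k ≪ a ℝ.^ k
  ≪-^ p zero    = ≪-ofReal (ℝ.<⇒0≤ ℝ.0<1)
  ≪-^ p (suc k) = ≪-* p (≪-^ p k)

  ≪-bounded : ∀ z → ∃ λ a → z ≪ a
  ≪-bounded (x +i y) with ℝ.∣∣-bounded x | ℝ.∣∣-bounded y
  ... | k , x≤k | l , y≤l = ℝ.fromℕ (suc k) ℝ.+ ℝ.fromℕ (suc l)
    , record { re≤ = x≤k ; im≤ = y≤l ; split = ℝ.refl }

  ≪-Σ< : ∀ {f F} → (∀ k → f k ≪ F k) → ∀ n → Σ< f n ≪ ℝ.Σ< F n
  ≪-Σ< f≪F zero    = ≪-ofReal ℝ.0≤0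
  ≪-Σ< f≪F (suc n) = ≪-+ (f≪F 0) (≪-Σ< (f≪F ∘ suc) n)

  ≪-corner : ∀ {f F g G} → (∀ k → f k ≪ F k) → (∀ k → g k ≪ G k) →
             ∀ n d → corner f g n d ≪ ℝ.corner F G n d
  ≪-corner f≪F g≪G zero    d = ≪-ofReal ℝ.0≤0
  ≪-corner f≪F g≪G (suc n) d = ≪-+ (≪-* (f≪F 0) (≪-Σ< (g≪G ∘ (suc n ℕ.+_)) d))
    (≪-corner (f≪F ∘ suc) g≪G n (suc d))

-- The complex exponential and its functional equation.

module ExponentialLemmas {c ℓ₁ ℓ₂ ℓ₃ : Level} (R : RealNumbers c ℓ₁ ℓ₂ ℓ₃) where
  private
    module ℝ where
      open RealNumbers R public
      open RealLemmas R public
      open CommutativeRingLemmas commutativeRing public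
  open ComplexNumbers R
  open ComplexLemmas R
  open CommutativeRing ℂ-ring
  open RingOps ℂ-ring
  open CommutativeRingLemmas ℂ-ring
  open ℝ using () renaming
    (_:+_ to _:+ᴿ_; _:*_ to _:*ᴿ_; _:-_ to _:-ᴿ_; :-_ to :-ᴿ_; _:=_ to _:=ᴿ_; con to conᴿ)
  open Relation.Binary.Reasoning.Setoid setoid

  fromℕᶜ-cancelˡ : ∀ k {z w} → fromℕ (suc k) * z ≈ fromℕ (suc k) * w → z ≈ w
  fromℕᶜ-cancelˡ k {z} {w} kz≈kw =
    ℝ.fromℕ-cancelˡ k (ℝ.trans (ℝ.sym (re≈ (scale z))) (ℝ.trans (re≈ kz≈kw) (re≈ (scale w)))) ,
    ℝ.fromℕ-cancelˡ k (ℝ.trans (ℝ.sym (im≈ (scale z))) (ℝ.trans (im≈ kz≈kw) (im≈ (scale w))))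
    where
    n = ℝ.fromℕ (suc k)
    scale : ∀ z → fromℕ (suc k) * z ≈ (n ℝ.* re z) +i (n ℝ.* im z)
    scale (a +i b) = trans (*-congʳ (sym (ofReal-fromℕ (suc k))))
      ( ℝ.solve 3 (λ n a b → n :*ᴿ a :-ᴿ conᴿ (+ 0) :*ᴿ b :=ᴿ n :*ᴿ a) ℝ.refl n a b
      , ℝ.solve 3 (λ n a b → n :*ᴿ b :+ᴿ conᴿ (+ 0) :*ᴿ a :=ᴿ n :*ᴿ b) ℝ.refl n a b)

  open ExponentialSequences fromℕᶜ-cancelˡ
  open IsExpSeq

  term : ℂ → ℕ → ℂ
  term z k = (z ^ k) * ofReal (ℝ.recip! k)

  term-isExpSeq : ∀ z → IsExpSeq z (term z)
  term-isExpSeq z .initial = trans (*-identityˡ _) (ofReal-cong ℝ.recip!-zero)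
  term-isExpSeq z .recursion k = begin
    fromℕ (suc k) * ((z * z ^ k) * ofReal (ℝ.recip! (suc k)))
      ≈⟨ solve 4 (λ n z p r → n :* ((z :* p) :* r) := z :* (p :* (n :* r))) refl _ z (z ^ k) _ ⟩
    z * (z ^ k * (fromℕ (suc k) * ofReal (ℝ.recip! (suc k))))
      ≈⟨ *-congˡ (*-congˡ (*-congʳ (ofReal-fromℕ (suc k)))) ⟨
    z * (z ^ k * (ofReal (ℝ.fromℕ (suc k)) * ofReal (ℝ.recip! (suc k))))
      ≈⟨ *-congˡ (*-congˡ (ofReal-* _ _)) ⟨
    z * (z ^ k * ofReal (ℝ.fromℕ (suc k) ℝ.* ℝ.recip! (suc k)))
      ≈⟨ *-congˡ (*-congˡ (ofReal-cong (ℝ.recip!-suc k))) ⟩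
    z * (z ^ k * ofReal (ℝ.recip! k)) ∎

  -- Identifies the real series of x with the complex series at x, whose convergence is known.
  ofReal-isExpSeq : ∀ {x a} → ℝ.IsExpSeq x a → IsExpSeq (ofReal x) (ofReal ∘ a)
  ofReal-isExpSeq p .initial = ofReal-cong (ℝ.IsExpSeq.initial p)
  ofReal-isExpSeq {x} {a} p .recursion k = begin
    fromℕ (suc k) * ofReal (a (suc k))             ≈⟨ *-congʳ (ofReal-fromℕ (suc k)) ⟨
    ofReal (ℝ.fromℕ (suc k)) * ofReal (a (suc k))  ≈⟨ ofReal-* _ _ ⟨
    ofReal (ℝ.fromℕ (suc k) ℝ.* a (suc k))         ≈⟨ ofReal-cong (ℝ.IsExpSeq.recursion p k) ⟩
    ofReal (x ℝ.* a k)                             ≈⟨ ofReal-* _ _ ⟩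
    ofReal x * ofReal (a k)                        ∎

  conj-isExpSeq : ∀ {z a} → IsExpSeq z a → IsExpSeq (conj z) (conj ∘ a)
  conj-isExpSeq p .initial = trans (conj-cong (initial p)) (conj-ofReal ℝ.1#)
  conj-isExpSeq {z} {a} p .recursion k = begin
    fromℕ (suc k) * conj (a (suc k))         ≈⟨ *-congʳ (conj-fromℕ (suc k)) ⟨
    conj (fromℕ (suc k)) * conj (a (suc k))  ≈⟨ conj-* _ _ ⟨
    conj (fromℕ (suc k) * a (suc k))         ≈⟨ conj-cong (recursion p k) ⟩
    conj (z * a k)                           ≈⟨ conj-* _ _ ⟩
    conj z * conj (a k)                      ∎

  isExpSeq-resp : ∀ {z w a} → z ≈ w → IsExpSeq z a → IsExpSeq w a
  isExpSeq-resp z≈w p .initial     = initial p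
  isExpSeq-resp z≈w p .recursion k = trans (recursion p k) (*-congʳ z≈w)

  term≪ : ∀ {z x} → z ≪ x → ∀ k → term z k ≪ ℝ.expTerm x k
  term≪ z≪x k = ≪-* (≪-^ z≪x k) (≪-ofReal (ℝ.0≤recip! k))

  module _ (exp : ℂ → ℂ) (isExp : IsExp exp) where

    partialSums-null : ∀ z → IsNullᶜ (λ n → Σ< (term z) n - exp z)
    partialSums-null z = ℝ.⟶⇒null (proj₁ (isExp z)) , ℝ.⟶⇒null (proj₂ (isExp z))

    -- Such a sequence has the same partial sums as the series of z, and limits are unique.
    -- Congruence, conjugation and the functional equation all follow by exhibiting a suitable
    -- sequence.
    exp-unique : ∀ {z L a} → IsExpSeq z a → IsNullᶜ (λ n → Σ< a n - L) → exp z ≈ L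
    exp-unique {z} {L} {a} a-expSeq a⟶L = x-y≈0⇒x≈y (nullᶜ-const (nullᶜ-resp
      (λ n → trans (+-congˡ (-‿cong (+-congʳ (Σ<-cong n (unique (term-isExpSeq z) a-expSeq)))))
         (solve 3 (λ s l e → (s :- l) :- (s :- e) := e :- l) refl (Σ< a n) L (exp z)))
      (nullᶜ-+ a⟶L (nullᶜ-neg (partialSums-null z)))))

    exp-cong : ∀ {z w} → z ≈ w → exp z ≈ exp w
    exp-cong {z} {w} z≈w = exp-unique (isExpSeq-resp (sym z≈w) (term-isExpSeq w)) (partialSums-null w)

    exp-conj : ∀ z → exp (conj z) ≈ conj (exp z)
    exp-conj z = exp-unique (conj-isExpSeq (term-isExpSeq z)) (nullᶜ-resp
      (λ n → trans (conj-+ _ _) (+-cong (conj-Σ< (term z) n) (conj-neg (exp z))))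
      (nullᶜ-conj (partialSums-null z)))
      where
      conj-neg : ∀ z → conj (- z) ≈ - conj z
      conj-neg _ = refl

    exp-0 : exp 0# ≈ 1#
    -- The partial sums at 0 equal 1 only from the first term on, the empty one being 0; hence the
    -- passage to the subsequence `suc`.
    exp-0 = sym (x-y≈0⇒x≈y (nullᶜ-const (nullᶜ-resp (λ n → +-congʳ (partialSum-0 n))
      (nullᶜ-subsequence {λ n → Σ< (term 0#) n - exp 0#} suc ℕ.n≤1+n (partialSums-null 0#)))))
      where
      partialSum-0 : ∀ n → Σ< (term 0#) (suc n) ≈ 1#
      partialSum-0 n = trans (+-cong (initial (term-isExpSeq 0#)) (trans
        (Σ<-cong {term 0# ∘ suc} n (λ k → trans (*-congʳ (zeroˡ (0# ^ k))) (zeroˡ (ofReal (ℝ.recip! (suc k))))))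
        (sum-replicate-zero n))) (+-identityʳ 1#)

    exp-+ : ∀ z w → exp (z + w) ≈ exp z * exp w
    exp-+ z w = exp-unique {a = conv (term z) (term w)} (conv-isExpSeq (term-isExpSeq z) (term-isExpSeq w))
      (nullᶜ-resp eq (nullᶜ-+ (null-products (partialSums-null z) (partialSums-null w))
        (nullᶜ-neg ( ℝ.null-dominated (λ n → ℝ.∣∣≤-mono (bound n) (∣re∣≤ (majorant n 0))) gap
                   , ℝ.null-dominated (λ n → ℝ.∣∣≤-mono (bound n) (∣im∣≤ (majorant n 0))) gap))))
      where
      x = proj₁ (≪-bounded z)
      y = proj₁ (≪-bounded w)
      H = ℝ.Σ< (ℝ.expTerm (x ℝ.+ y))
      F≪ : ∀ k → term z k ≪ ℝ.expTerm x k
      F≪ = term≪ (proj₂ (≪-bounded z))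
      G≪ : ∀ k → term w k ≪ ℝ.expTerm y k
      G≪ = term≪ (proj₂ (≪-bounded w))
      majorant = ≪-corner F≪ G≪
      bound = ℝ.corner-bound (ℝ.∣∣≤⇒0≤ ∘ ∣re∣≤ ∘ F≪) (ℝ.∣∣≤⇒0≤ ∘ ∣re∣≤ ∘ G≪)
      -- The real part of this value is the limit of the real majorant series, so `H (n + n)` and
      -- `H n` have a common limit and their difference is null.
      L = exp (ofReal (x ℝ.+ y))
      H⟶L : ℝ.IsNull (λ n → H n ℝ.- re L)
      H⟶L = ℝ.null-resp (λ n → ℝ.+-congʳ (re≈ (trans
          (Σ<-cong n (unique (term-isExpSeq _) (ofReal-isExpSeq (ℝ.expTerm-isExpSeq (x ℝ.+ y)))))
          (sym (ofReal-Σ< (ℝ.expTerm (x ℝ.+ y)) n)))))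
        (re-null (partialSums-null (ofReal (x ℝ.+ y))))
      gap : ℝ.IsNull (λ n → H (n ℕ.+ n) ℝ.- H n)
      gap = ℝ.null-resp (λ n → ℝ.solve 3 (λ p q l → (p :-ᴿ l) :+ᴿ :-ᴿ (q :-ᴿ l) :=ᴿ p :-ᴿ q) ℝ.refl _ _ (re L))
        (ℝ.null-+ (ℝ.null-subsequence (λ n → n ℕ.+ n) (λ n → ℕ.m≤m+n n n) H⟶L) (ℝ.null-neg H⟶L))
      -- The square minus its corner is the triangle, that is, the partial sum of the Cauchy
      -- product.
      eq : ∀ n → (Σ< (term z) n * Σ< (term w) n - exp z * exp w) + - corner (term z) (term w) n 0
               ≈ Σ< (conv (term z) (term w)) n - exp z * exp w
      eq n = begin
        (Σ< (term z) n * Σ< (term w) n - P) + - D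
          ≡⟨ ≡.cong (λ k → (Σ< (term z) n * Σ< (term w) k - P) + - D) (ℕ.+-identityʳ n) ⟨
        (Σ< (term z) n * Σ< (term w) (n ℕ.+ 0) - P) + - D
          ≈⟨ +-congʳ (+-congʳ (rectangle (term z) (term w) n 0)) ⟩
        (T + D - P) + - D
          ≈⟨ solve 3 (λ t d p → (t :+ d :- p) :+ :- d := t :- p) refl T D P ⟩
        T - P
          ≈⟨ +-congʳ (Σ<-conv (term z) (term w) n) ⟨
        Σ< (conv (term z) (term w)) n - P ∎
        where
        P = exp z * exp w
        D = corner (term z) (term w) n 0
        T = triangle (term z) (term w) n

-- Points of the unit circle and the period 2π.

module UnitCircle {c ℓ₁ ℓ₂ ℓ₃ : Level} (R : RealNumbers c ℓ₁ ℓ₂ ℓ₃)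
  (exp : ComplexNumbers.ℂ R → ComplexNumbers.ℂ R) (isExp : ComplexNumbers.IsExp R exp)
  (π : RealNumbers.Carrier R) (isPi : ComplexNumbers.IsPi R exp π) where
  open ComplexNumbers R
  private
    module ℝ where
      open RealNumbers R public
      open RealLemmas R public
      open CommutativeRingLemmas commutativeRing public
  open ComplexLemmas R
  open ExponentialLemmas R
  open CommutativeRing ℂ-ring
  open RingOps ℂ-ring
  open CommutativeRingLemmas ℂ-ring
  open ℝ using () renaming
    (_:+_ to _:+ᴿ_; _:*_ to _:*ᴿ_; _:-_ to _:-ᴿ_; :-_ to :-ᴿ_; _:=_ to _:=ᴿ_; con to conᴿ)
  open Relation.Binary.Reasoning.Setoid setoid
  private module π = IsPi isPi

  cis : ℝ.Carrier → ℂ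
  cis x = exp (i * ofReal x)

  cis-cong : ∀ {x y} → x ℝ.≈ y → cis x ≈ cis y
  cis-cong x≈y = exp-cong exp isExp (*-congˡ (ofReal-cong x≈y))

  cis-+ : ∀ x y → cis (x ℝ.+ y) ≈ cis x * cis y
  cis-+ x y = trans
    (exp-cong exp isExp (trans (*-congˡ (ofReal-+ x y)) (distribˡ i (ofReal x) (ofReal y))))
    (exp-+ exp isExp _ _)

  cis-0 : cis ℝ.0# ≈ 1#
  cis-0 = trans (exp-cong exp isExp (zeroʳ i)) (exp-0 exp isExp)

  -- On the imaginary axis negation is conjugation, and exp commutes with conjugation.
  cis-neg : ∀ x → cis (ℝ.- x) ≈ conj (cis x)
  cis-neg x = trans (exp-cong exp isExp
      ( ℝ.solve 1 (λ x → conᴿ (+ 0) :*ᴿ (:-ᴿ x) :-ᴿ conᴿ (+ 1) :*ᴿ conᴿ (+ 0)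
          :=ᴿ conᴿ (+ 0) :*ᴿ x :-ᴿ conᴿ (+ 1) :*ᴿ conᴿ (+ 0)) ℝ.refl x
      , ℝ.solve 1 (λ x → conᴿ (+ 0) :*ᴿ conᴿ (+ 0) :+ᴿ conᴿ (+ 1) :*ᴿ (:-ᴿ x)
          :=ᴿ :-ᴿ (conᴿ (+ 0) :*ᴿ conᴿ (+ 0) :+ᴿ conᴿ (+ 1) :*ᴿ x)) ℝ.refl x))
    (exp-conj exp isExp (i * ofReal x))

  cis-inverse : ∀ x → cis x * cis (ℝ.- x) ≈ 1#
  cis-inverse x = trans (sym (cis-+ x (ℝ.- x))) (trans (cis-cong (ℝ.-‿inverseʳ x)) cis-0)

  cis-neg≈1 : ∀ {x} → cis x ≈ 1# → cis (ℝ.- x) ≈ 1#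
  cis-neg≈1 {x} cisx≈1 = trans (cis-neg x) (trans (conj-cong cisx≈1) (conj-ofReal ℝ.1#))

  cis-multiple : ∀ {x} → cis x ≈ 1# → ∀ k → cis (ℝ.fromℕ k ℝ.* x) ≈ 1#
  cis-multiple {x} cisx≈1 zero    = trans (cis-cong (ℝ.zeroˡ x)) cis-0
  cis-multiple {x} cisx≈1 (suc k) = begin
    cis ((ℝ.1# ℝ.+ ℝ.fromℕ k) ℝ.* x)  ≈⟨ cis-cong (ℝ.solve 2 (λ n x →
                                           (conᴿ (+ 1) :+ᴿ n) :*ᴿ x :=ᴿ x :+ᴿ n :*ᴿ x) ℝ.refl _ x) ⟩
    cis (x ℝ.+ ℝ.fromℕ k ℝ.* x)       ≈⟨ cis-+ _ _ ⟩
    cis x * cis (ℝ.fromℕ k ℝ.* x)     ≈⟨ *-cong cisx≈1 (cis-multiple cisx≈1 k) ⟩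
    1# * 1#                           ≈⟨ *-identityˡ 1# ⟩
    1#                                ∎

  cis-multipleᶻ : ∀ {x} → cis x ≈ 1# → ∀ w → cis (ℝ.fromℤ w ℝ.* x) ≈ 1#
  cis-multipleᶻ cisx≈1 (+ k)    = cis-multiple cisx≈1 k
  cis-multipleᶻ cisx≈1 -[1+ k ] = trans (cis-cong (ℝ.sym (ℝ.-‿distribˡ-* _ _)))
    (cis-neg≈1 (cis-multiple cisx≈1 (suc k)))

  -- sin π = 0 makes cis π real, hence equal to its conjugate cis (- π).
  cis-2π : cis (π ℝ.+ π) ≈ 1#
  cis-2π = begin
    cis (π ℝ.+ π)           ≈⟨ cis-+ π π ⟩
    cis π * cis π           ≈⟨ *-congˡ cisπ-real ⟩
    cis π * conj (cis π)    ≈⟨ *-congˡ (cis-neg π) ⟨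
    cis π * cis (ℝ.- π)     ≈⟨ cis-inverse π ⟩
    1#                      ∎
    where
    cisπ-real : cis π ≈ conj (cis π)
    cisπ-real = ℝ.refl , ℝ.trans π.zero-π (ℝ.sym (ℝ.trans (ℝ.-‿cong π.zero-π) ℝ.-0#≈0#))

  -- From (c + is)² = 1 with s apart from 0 one gets c = 0 and - s² = 1;
  -- so s = 0, against the minimality of π.
  cis≉1 : ∀ {x} → ℝ.0# ℝ.< x → x ℝ.< π → ¬ cis (x ℝ.+ x) ≈ 1#
  cis≉1 {x} 0<x x<π cis2x≈1 = π.smallest x 0<x x<π (proj₁ (ℝ.tight s ℝ.0#) s#0⇒⊥)
    where
    c₀ = re (cis x)
    s = im (cis x)
    square≈1 : cis x * cis x ≈ 1#
    square≈1 = trans (sym (cis-+ x x)) cis2x≈1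
    s#0⇒⊥ : ¬ (s ℝ.# ℝ.0#)
    s#0⇒⊥ s#0 = ℝ.0≤-square s (ℝ.0<y-x⇒x<y (ℝ.<-respʳ 1≈-s² ℝ.0<1))
      where
      c≈0 : c₀ ℝ.≈ ℝ.0#
      c≈0 = ℝ.fromℕ-cancelˡ 1 (ℝ.trans
        (ℝ.solve 1 (λ y → (conᴿ (+ 1) :+ᴿ (conᴿ (+ 1) :+ᴿ conᴿ (+ 0))) :*ᴿ y :=ᴿ y :+ᴿ y) ℝ.refl c₀)
        (ℝ.trans (ℝ.#0-cancelˡ s#0 (ℝ.trans
          (ℝ.solve 2 (λ s c → s :*ᴿ (c :+ᴿ c) :=ᴿ c :*ᴿ s :+ᴿ s :*ᴿ c) ℝ.refl s c₀) (im≈ square≈1)))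
          (ℝ.sym (ℝ.zeroʳ _))))
      1≈-s² : ℝ.1# ℝ.≈ ℝ.0# ℝ.- s ℝ.* s
      1≈-s² = ℝ.trans (ℝ.sym (re≈ square≈1)) (ℝ.+-congʳ (ℝ.trans (ℝ.*-congʳ c≈0) (ℝ.zeroˡ c₀)))

  -- Roots of unity of order l.

  module _ (l : ℕ) .{{_ : NonZero l}} where

    root : ℤ → ℕ → ℂ
    root = expAt exp π l

    root-+ : ∀ v w m → root (v ℤ.+ w) m ≈ root v m * root w m
    root-+ v w m = trans (cis-cong (ℝ.trans (ℝ.*-congʳ (ℝ.*-congʳ (ℝ.fromℤ-+ v w)))
      (ℝ.solve 4 (λ v w t m → (v :+ᴿ w) :*ᴿ t :*ᴿ m :=ᴿ v :*ᴿ t :*ᴿ m :+ᴿ w :*ᴿ t :*ᴿ m) ℝ.refl _ _ _ _)))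
      (cis-+ _ _)

    root-0 : ∀ m → root ℤ.0ℤ m ≈ 1#
    root-0 m = trans (cis-cong (ℝ.trans (ℝ.*-congʳ (ℝ.zeroˡ _)) (ℝ.zeroˡ _))) cis-0

    root-suc : ∀ w m → root w (suc m) ≈ root w 1 * root w m
    root-suc w m = trans (cis-cong (ℝ.solve 2 (λ x m →
        x :*ᴿ (conᴿ (+ 1) :+ᴿ m) :=ᴿ x :*ᴿ (conᴿ (+ 1) :+ᴿ conᴿ (+ 0)) :+ᴿ x :*ᴿ m) ℝ.refl _ _))
      (cis-+ _ _)

    root-l : ∀ w → root w l ≈ 1#
    root-l w = trans (cis-cong (ℝ.trans
        (ℝ.solve 4 (λ w p r n → w :*ᴿ ((conᴿ (+ 1) :+ᴿ (conᴿ (+ 1) :+ᴿ conᴿ (+ 0))) :*ᴿ p :*ᴿ r) :*ᴿ n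
          :=ᴿ (r :*ᴿ n) :*ᴿ (w :*ᴿ (p :+ᴿ p))) ℝ.refl (ℝ.fromℤ w) π (ℝ.recip l) (ℝ.fromℕ l))
        (ℝ.trans (ℝ.*-congʳ (ℝ.recip-inverseˡ l)) (ℝ.*-identityˡ _))))
      (cis-multipleᶻ cis-2π w)

    -- The minimality of π is applied to half the angle, x = (k+1)π/l. That x < π holds because π -
    -- x = (l-k-1)π/l is a positive multiple of π/l, the number `suc d` being l - (k+1).
    root⁺≉1 : ∀ k → suc k ℕ.< l → ¬ root (+ suc k) 1 ≈ 1#
    root⁺≉1 k k<l rt≈1 = cis≉1 0<x x<π (trans (cis-cong double) rt≈1)
      where
      r = ℝ.recip l
      x = ℝ.fromℕ (suc k) ℝ.* (π ℝ.* r)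
      d = l ℕ.∸ suc (suc k)
      l≡ : l ≡ suc k ℕ.+ suc d
      l≡ = ≡.sym (≡.trans (ℕ.+-suc (suc k) d) (ℕ.m+[n∸m]≡n k<l))
      0<πr : ℝ.0# ℝ.< π ℝ.* r
      0<πr = ℝ.*-pos π.positive (ℝ.0<-recip l)
      0<x : ℝ.0# ℝ.< x
      0<x = ℝ.*-pos (ℝ.0<fromℕ k) 0<πr
      π≈ : ℝ.fromℕ (suc d) ℝ.* (π ℝ.* r) ℝ.≈ π ℝ.- x
      π≈ = ℝ.trans (ℝ.solve 4 (λ d k p r → d :*ᴿ (p :*ᴿ r) :=ᴿ (r :*ᴿ (k :+ᴿ d)) :*ᴿ p :-ᴿ k :*ᴿ (p :*ᴿ r))
          ℝ.refl (ℝ.fromℕ (suc d)) (ℝ.fromℕ (suc k)) π r)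
        (ℝ.+-congʳ (ℝ.trans (ℝ.*-congʳ (ℝ.trans (ℝ.*-congˡ (ℝ.trans
            (ℝ.sym (ℝ.fromℕ-+ (suc k) (suc d))) (ℝ.reflexive (≡.cong ℝ.fromℕ (≡.sym l≡)))))
          (ℝ.recip-inverseˡ l))) (ℝ.*-identityˡ π)))
      x<π : x ℝ.< π
      x<π = ℝ.0<y-x⇒x<y (ℝ.<-respʳ π≈ (ℝ.*-pos (ℝ.0<fromℕ d) 0<πr))
      double : x ℝ.+ x ℝ.≈ ℝ.fromℕ (suc k) ℝ.* (ℝ.fromℕ 2 ℝ.* π ℝ.* r) ℝ.* ℝ.fromℕ 1
      double = ℝ.solve 3 (λ k p r → k :*ᴿ (p :*ᴿ r) :+ᴿ k :*ᴿ (p :*ᴿ r) :=ᴿ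
        k :*ᴿ ((conᴿ (+ 1) :+ᴿ (conᴿ (+ 1) :+ᴿ conᴿ (+ 0))) :*ᴿ p :*ᴿ r) :*ᴿ (conᴿ (+ 1) :+ᴿ conᴿ (+ 0)))
        ℝ.refl (ℝ.fromℕ (suc k)) π r

    root≉1 : ∀ w → 1 ℕ.≤ ∣ w ∣ → ∣ w ∣ ℕ.< l → ¬ root w 1 ≈ 1#
    root≉1 +[1+ k ] _ k<l      = root⁺≉1 k k<l
    -- Opposite exponents give inverse roots, so both are 1 as soon as one is.
    root≉1 -[1+ k ] _ k<l rt≈1 = root⁺≉1 k k<l (begin
      root +[1+ k ] 1                     ≈⟨ *-identityˡ _ ⟨
      1# * root +[1+ k ] 1                ≈⟨ *-congʳ rt≈1 ⟨
      root -[1+ k ] 1 * root +[1+ k ] 1   ≈⟨ root-+ -[1+ k ] +[1+ k ] 1 ⟨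
      root (-[1+ k ] ℤ.+ +[1+ k ]) 1      ≡⟨ ≡.cong (λ w → root w 1) (ℤ.+-inverseˡ +[1+ k ]) ⟩
      root ℤ.0ℤ 1                         ≈⟨ root-0 1 ⟩
      1#                                  ∎)

    -- A geometric sum: with ω = `root w 1`, multiplication by ω - 1 telescopes. As m starts at 1,
    -- the ends are ω^(l+1) and ω, which agree because ω^l = 1.
    sum-root≈0 : ∀ w → 1 ℕ.≤ ∣ w ∣ → ∣ w ∣ ℕ.< l → sum {l} (λ m → root w (suc (toℕ m))) ≈ 0#
    sum-root≈0 w 1≤w w<l = *≈0⇒≈0 (trans (telescope (root w ∘ suc) (root-suc w ∘ suc) l) (x≈y⇒x-y≈0 (begin
      root w (suc l)       ≈⟨ root-suc w l ⟩
      root w 1 * root w l  ≈⟨ *-congˡ (root-l w) ⟩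
      root w 1 * 1#        ≈⟨ *-identityʳ _ ⟩
      root w 1             ∎))) (root≉1 w 1≤w w<l ∘ x-y≈0⇒x≈y)
      where
      telescope : ∀ {x} f → (∀ k → f (suc k) ≈ x * f k) → ∀ n → (x - 1#) * Σ< f n ≈ f n - f 0
      telescope {x} f step zero    = trans (zeroʳ _) (sym (-‿inverseʳ _))
      telescope {x} f step (suc n) = begin
        (x - 1#) * (f 0 + Σ< (f ∘ suc) n)
          ≈⟨ solve 3 (λ x f s → (x :- con (+ 1)) :* (f :+ s) := (x :* f :- f) :+ (x :- con (+ 1)) :* s)
               refl x (f 0) _ ⟩
        (x * f 0 - f 0) + (x - 1#) * Σ< (f ∘ suc) n
          ≈⟨ +-cong (+-congʳ (sym (step 0))) (telescope (f ∘ suc) (step ∘ suc) n) ⟩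
        (f 1 - f 0) + (f (suc n) - f 1)
          ≈⟨ solve 3 (λ a b c → (b :- a) :+ (c :- b) := c :- a) refl (f 0) (f 1) (f (suc n)) ⟩
        f (suc n) - f 0 ∎

-- Laurent polynomials: expansion over sign vectors, evaluation and exponents.

module LaurentLemmas {c ℓ : Level} (R : CommutativeRing c ℓ) (n : ℕ) where
  open CommutativeRing R
  open RingOps R
  open LaurentPolynomials R n
  open CommutativeRingLemmas R
  open Relation.Binary.Reasoning.Setoid setoid

  private
    𝟎 : Vec ℤ n
    𝟎 = replicate n ℤ.0ℤ

  IsSignVector : Vec ℤ n → Set
  IsSignVector = VecAll.All (λ x → x ≡ ℤ.-1ℤ ⊎ x ≡ ℤ.0ℤ ⊎ x ≡ ℤ.1ℤ)

  coeff-≡ : ∀ {a d e} p → d ≡ e → coeff ((a , d) ∷ p) e ≈ a + coeff p e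
  coeff-≡ {_} {d} {e} p d≡e with Vec.≡-dec ℤ._≟_ d e
  ... | yes _  = refl
  ... | no d≢e = contradiction d≡e d≢e

  coeff-≢ : ∀ {a d e} p → d ≢ e → coeff ((a , d) ∷ p) e ≈ coeff p e
  coeff-≢ {_} {d} {e} p d≢e with Vec.≡-dec ℤ._≟_ d e
  ... | yes d≡e = contradiction d≡e d≢e
  ... | no _    = refl

  monomial : Carrier × Vec ℤ n → Laurent
  monomial t = t ∷ []

  coeff-∷ : ∀ t p e → coeff (t ∷ p) e ≈ coeff (monomial t) e + coeff p e
  coeff-∷ (a , d) p e with Vec.≡-dec ℤ._≟_ d e
  ... | yes _ = +-congʳ (sym (+-identityʳ a))
  ... | no  _ = sym (+-identityˡ _)

  sum≈0 : ∀ {m} (f : Fin m → Carrier) → (∀ j → f j ≈ 0#) → sum f ≈ 0#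
  sum≈0 {m} f f≈0 = trans (sum-cong-≋ {m} f≈0) (sum-replicate-zero m)

  sum-single : ∀ {m} (f : Fin m → Carrier) k → (∀ j → j ≢ k → f j ≈ 0#) → sum f ≈ f k
  sum-single {suc m} f Fin.zero f≈0 = trans
    (+-congˡ (sum≈0 (f ∘ Fin.suc) λ j → f≈0 (Fin.suc j) λ ()))
    (+-identityʳ _)
  sum-single {suc m} f (Fin.suc k) f≈0 = trans
    (+-cong (f≈0 Fin.zero λ ()) (sum-single (f ∘ Fin.suc) k λ j j≢k → f≈0 (Fin.suc j) (j≢k ∘ Fin.suc-injective)))
    (+-identityˡ _)

  module _ (x : Fin n → Carrier) (x-unit : ∀ j → IsUnit (x j)) where

    power : Vec ℤ n → Carrier
    power e = product λ j → zpow (x j) (x-unit j) (lookup e j)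

    product≈1 : ∀ {m} {f : Fin m → Carrier} → (∀ j → f j ≈ 1#) → product f ≈ 1#
    product≈1 {zero}  f≈1 = refl
    product≈1 {suc m} f≈1 = trans (*-cong (f≈1 Fin.zero) (product≈1 (f≈1 ∘ Fin.suc))) (*-identityˡ 1#)

    power-𝟎 : power 𝟎 ≈ 1#
    power-𝟎 = product≈1 λ j →
      reflexive (≡.cong (zpow (x j) (x-unit j)) (Vec.lookup-replicate j ℤ.0ℤ))

    module _ (enum : SignVectorEnumeration n) where
      open SignVectorEnumeration enum

      expansion : Laurent → Carrier
      expansion p = sum (λ k → coeff p (vec k) * power (vec k)) + constantTerm p

      -- A zero exponent vector contributes to the constant term alone. A non-zero one is
      -- enumerated, by completeness, and only once, by injectivity.
      expansion-monomial : ∀ {a d} → IsSignVector d → expansion (monomial (a , d)) ≈ a * power d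
      expansion-monomial {a} {d} d-sign = cases (Vec.≡-dec ℤ._≟_ d 𝟎)
        where
        cases : Dec (d ≡ 𝟎) → expansion (monomial (a , d)) ≈ a * power d
        cases (yes d≡𝟎) = begin
          sum (λ k → coeff (monomial (a , d)) (vec k) * power (vec k)) + constantTerm (monomial (a , d))
            ≈⟨ +-cong (sum≈0 _ λ k → trans (*-congʳ (coeff-≢ [] (d≢vec k))) (zeroˡ _))
                      (trans (coeff-≡ [] d≡𝟎) (+-identityʳ a)) ⟩
          0# + a
            ≈⟨ trans (+-identityˡ a) (sym (*-identityʳ a)) ⟩
          a * 1#
            ≈⟨ *-congˡ (trans (reflexive (≡.cong power d≡𝟎)) power-𝟎) ⟨
          a * power d ∎
          where
          d≢vec : ∀ k → d ≢ vec k
          d≢vec k d≡vec = proj₂ (sound k) (≡.trans (≡.sym d≡vec) d≡𝟎)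
        cases (no d≢𝟎) = begin
          sum (λ k → coeff (monomial (a , d)) (vec k) * power (vec k)) + constantTerm (monomial (a , d))
            ≈⟨ +-cong (sum-single _ k₀ λ k k≢k₀ → trans (*-congʳ (coeff-≢ [] (d≢vec k k≢k₀))) (zeroˡ _))
                      (coeff-≢ [] d≢𝟎) ⟩
          coeff (monomial (a , d)) (vec k₀) * power (vec k₀) + 0#
            ≈⟨ +-identityʳ _ ⟩
          coeff (monomial (a , d)) (vec k₀) * power (vec k₀)
            ≈⟨ *-cong (trans (coeff-≡ [] (≡.sym vec≡d)) (+-identityʳ a)) (reflexive (≡.cong power vec≡d)) ⟩
          a * power d ∎
          where
          k₀ = proj₁ (complete d (d-sign , d≢𝟎))
          vec≡d = proj₂ (complete d (d-sign , d≢𝟎))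
          d≢vec : ∀ k → k ≢ k₀ → d ≢ vec k
          d≢vec k k≢k₀ d≡vec = k≢k₀ (injective (≡.trans (≡.sym d≡vec) (≡.sym vec≡d)))

      -- Both sides are additive in the list of terms, so repeated exponent vectors need no
      -- collecting.
      eval≈expansion : ∀ {p} → All (IsSignVector ∘ proj₂) p → eval p x x-unit ≈ expansion p
      eval≈expansion {[]} [] = sym (trans
        (+-congʳ (sum≈0 (λ k → 0# * power (vec k)) λ k → zeroˡ (power (vec k))))
        (+-identityʳ 0#))
      eval≈expansion {t@(a , d) ∷ p} (d-sign ∷ p-sign) = begin
        a * power d + eval p x x-unit
          ≈⟨ +-cong (sym (expansion-monomial d-sign)) (eval≈expansion p-sign) ⟩
        (sum (λ k → c₁ k * power (vec k)) + constantTerm (monomial t)) + (sum (λ k → c₂ k * power (vec k)) + constantTerm p)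
          ≈⟨ solve 4 (λ a b c d → (a :+ b) :+ (c :+ d) := (a :+ c) :+ (b :+ d)) refl _ _ _ _ ⟩
        (sum (λ k → c₁ k * power (vec k)) + sum (λ k → c₂ k * power (vec k))) + (constantTerm (monomial t) + constantTerm p)
          ≈⟨ +-cong (sym (∑-distrib-+ (λ k → c₁ k * power (vec k)) (λ k → c₂ k * power (vec k))))
                    (sym (coeff-∷ t p 𝟎)) ⟩
        sum (λ k → c₁ k * power (vec k) + c₂ k * power (vec k)) + constantTerm (t ∷ p)
          ≈⟨ +-congʳ (sum-cong-≋ λ k → trans (sym (distribʳ _ _ _)) (*-congʳ (sym (coeff-∷ t p (vec k))))) ⟩
        expansion (t ∷ p) ∎
        where
        c₁ c₂ : Fin (3 ℕ.^ n ℕ.∸ 1) → Carrier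
        c₁ k = coeff (monomial t) (vec k)
        c₂ k = coeff p (vec k)

  -- A homomorphism E from the additive group of integers into the units. At X_j = E(z_j) a monomial
  -- with exponents e_j takes the value E(Σ e_j z_j), which is how z(A_k) enters.
  module Character (E : ℤ → Carrier)
    (E-+ : ∀ v w → E (v ℤ.+ w) ≈ E v * E w) (E-0 : E ℤ.0ℤ ≈ 1#) where

    E-unit : ∀ w → IsUnit (E w)
    E-unit w = E (ℤ.- w) , inverse , trans (*-comm _ _) inverse
      where
      inverse : E (ℤ.- w) * E w ≈ 1#
      inverse = trans (sym (E-+ (ℤ.- w) w)) (trans (reflexive (≡.cong E (ℤ.+-inverseˡ w))) E-0)

    E-^ : ∀ w k → E w ^ k ≈ E (+ k ℤ.* w)
    E-^ w zero    = sym E-0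
    E-^ w (suc k) = begin
      E w * E w ^ k            ≈⟨ *-congˡ (E-^ w k) ⟩
      E w * E (+ k ℤ.* w)      ≈⟨ E-+ w (+ k ℤ.* w) ⟨
      E (w ℤ.+ + k ℤ.* w)      ≡⟨ ≡.cong E (ℤ.suc-* (+ k) w) ⟨
      E (+ suc k ℤ.* w)        ∎

    E-zpow : ∀ w k → zpow (E w) (E-unit w) k ≈ E (k ℤ.* w)
    E-zpow w (+ k)    = E-^ w k
    E-zpow w -[1+ k ] = trans (E-^ (ℤ.- w) (suc k)) (reflexive (≡.cong E
      (≡.trans (≡.sym (ℤ.neg-distribʳ-* (+ suc k) w)) (ℤ.neg-distribˡ-* (+ suc k) w))))

    E-product : ∀ {m} (f : Fin m → Carrier) (g : Fin m → ℤ) → (∀ j → f j ≈ E (g j)) →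
                product f ≈ E (List.foldr ℤ._+_ ℤ.0ℤ (List.tabulate g))
    E-product {zero}  f g f≈Eg = sym E-0
    E-product {suc m} f g f≈Eg = trans
      (*-cong (f≈Eg Fin.zero) (E-product (f ∘ Fin.suc) (g ∘ Fin.suc) (f≈Eg ∘ Fin.suc)))
      (sym (E-+ _ _))

    E-power : ∀ z e → power (E ∘ z) (E-unit ∘ z) e ≈ E (combination e z)
    E-power z e = E-product _ (λ j → lookup e j ℤ.* z j) λ j → E-zpow (z j) (lookup e j)

  -- The set P of indices with a possibly non-zero exponent is recorded because only a product over
  -- disjoint sets keeps the exponents in {0, v}; otherwise 2v could occur.
  Supported : ℤ → (Fin n → Set) → Laurent → Set c
  Supported v P = All λ t → ∀ j → lookup (proj₂ t) j ≡ ℤ.0ℤ ⊎ P j × lookup (proj₂ t) j ≡ v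

  private
    variable
      v : ℤ
      P Q : Fin n → Set
      p q : Laurent

  supported-mono : (∀ {j} → P j → Q j) → Supported v P p → Supported v Q p
  supported-mono P⊆Q = All.map λ s j → Sum.map₂ (λ (Pj , dj≡v) → P⊆Q Pj , dj≡v) (s j)

  supported-const : ∀ {a} → Supported v P (const a)
  supported-const = (λ j → inj₁ (Vec.lookup-replicate j ℤ.0ℤ)) ∷ []

  supported-X : ∀ i → Supported v (_≡ i) (X[ i ]^ v)
  supported-X {v} i = entries ∷ []
    where
    entries : ∀ j → lookup (𝟎 [ i ]≔ v) j ≡ ℤ.0ℤ ⊎ j ≡ i × lookup (𝟎 [ i ]≔ v) j ≡ v
    entries j with j Fin.≟ i
    ... | yes ≡.refl = inj₂ (≡.refl , Vec.lookup∘update i 𝟎 v)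
    ... | no  j≢i    = inj₁ (≡.trans (Vec.lookup∘update′ j≢i 𝟎 v) (Vec.lookup-replicate j ℤ.0ℤ))

  supported-⊕ : Supported v P p → Supported v P q → Supported v P (p ⊕ q)
  supported-⊕ = All.++⁺

  supported-⊗ : (∀ {j} → P j → Q j → ⊥) →
                Supported v P p → Supported v Q q → Supported v (λ j → P j ⊎ Q j) (p ⊗ q)
  supported-⊗ {P} {Q} {v} {p} {q} disjoint p-supp q-supp =
    All.cartesianProductWith⁺ (≡.setoid _) (≡.setoid _) _ p q λ {t} {u} t∈p u∈q j →
      ≡.subst (λ x → x ≡ ℤ.0ℤ ⊎ (P j ⊎ Q j) × x ≡ v)
        (≡.sym (Vec.lookup-zipWith ℤ._+_ j (proj₂ t) (proj₂ u)))
        (entries (All.lookup p-supp t∈p j) (All.lookup q-supp u∈q j))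
    where
    entries : ∀ {j x y} → x ≡ ℤ.0ℤ ⊎ P j × x ≡ v → y ≡ ℤ.0ℤ ⊎ Q j × y ≡ v →
              x ℤ.+ y ≡ ℤ.0ℤ ⊎ (P j ⊎ Q j) × x ℤ.+ y ≡ v
    entries (inj₁ ≡.refl)        (inj₁ ≡.refl)        = inj₁ ≡.refl
    entries (inj₁ ≡.refl)        (inj₂ (Qj , ≡.refl)) = inj₂ (inj₂ Qj , ℤ.+-identityˡ _)
    entries (inj₂ (Pj , ≡.refl)) (inj₁ ≡.refl)        = inj₂ (inj₁ Pj , ℤ.+-identityʳ _)
    entries (inj₂ (Pj , _))      (inj₂ (Qj , _))      = contradiction Qj (disjoint Pj)

  supported-∏ : ∀ {I : Set} {P : I → Fin n → Set} {g : I → Laurent} →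
                (∀ {x y j} → x ≢ y → P x j → P y j → ⊥) →
                (∀ x → Supported v (P x) (g x)) →
                ∀ {xs} → Unique xs → Supported v (λ j → Any (λ x → P x j) xs) (∏ (List.map g xs))
  supported-∏ disjoint g-supp [] = supported-const
  supported-∏ {P = P} disjoint g-supp {x ∷ xs} (x∉xs ∷ xs-unique) =
    supported-mono [ here , there ]′
      (supported-⊗ (λ Px Pxs → separate x∉xs Px Pxs) (g-supp x) (supported-∏ disjoint g-supp xs-unique))
    where
    separate : ∀ {j ys} → All (x ≢_) ys → P x j → Any (λ y → P y j) ys → ⊥
    separate (x≢y ∷ _)   Px (here Py)   = disjoint x≢y Px Py
    separate (_ ∷ x∉ys)  Px (there Pys) = separate x∉ys Px Pys

  IsSignPolynomial : Laurent → Set c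
  IsSignPolynomial = All (IsSignVector ∘ proj₂)

  signPolynomial-const : ∀ {a} → IsSignPolynomial (const a)
  signPolynomial-const =
    VecAll.lookup⁻ (λ j → inj₂ (inj₁ (Vec.lookup-replicate j ℤ.0ℤ))) ∷ []

  -- Here P and Q may overlap: exponents 1 and -1 at the same index cancel.
  signPolynomial-⊗ : Supported ℤ.1ℤ P p → Supported ℤ.-1ℤ Q q → IsSignPolynomial (p ⊗ q)
  signPolynomial-⊗ {P} {p} {Q} {q} p-supp q-supp =
    All.cartesianProductWith⁺ (≡.setoid _) (≡.setoid _) _ p q λ {t} {u} t∈p u∈q →
      VecAll.lookup⁻ λ j → ≡.subst (λ x → x ≡ ℤ.-1ℤ ⊎ x ≡ ℤ.0ℤ ⊎ x ≡ ℤ.1ℤ)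
        (≡.sym (Vec.lookup-zipWith ℤ._+_ j (proj₂ t) (proj₂ u)))
        (entries (All.lookup p-supp t∈p j) (All.lookup q-supp u∈q j))
    where
    entries : ∀ {j x y} → x ≡ ℤ.0ℤ ⊎ P j × x ≡ ℤ.1ℤ → y ≡ ℤ.0ℤ ⊎ Q j × y ≡ ℤ.-1ℤ →
              x ℤ.+ y ≡ ℤ.-1ℤ ⊎ x ℤ.+ y ≡ ℤ.0ℤ ⊎ x ℤ.+ y ≡ ℤ.1ℤ
    entries (inj₁ ≡.refl)       (inj₁ ≡.refl)       = inj₂ (inj₁ ≡.refl)
    entries (inj₁ ≡.refl)       (inj₂ (_ , ≡.refl)) = inj₁ ≡.refl
    entries (inj₂ (_ , ≡.refl)) (inj₁ ≡.refl)       = inj₂ (inj₂ ≡.refl)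
    entries (inj₂ (_ , ≡.refl)) (inj₂ (_ , ≡.refl)) = inj₂ (inj₁ ≡.refl)

-- Exponents occurring in the logical formula.

module LogicalFormulaLemmas {c ℓ : Level} (R : CommutativeRing c ℓ)
  (½ : CommutativeRing.Carrier R) {M N : ℕ} (φ : CNF₃ M N) where
  open CommutativeRing R
  open LaurentPolynomials R (M ℕ.* 3)
  open LaurentLemmas R (M ℕ.* 3)
  open CNF₃ φ
  open LogicalFormula R ½ φ

  -- The three literals of a clause are different occurrences and carry different variables, so no
  -- exponent reaches 2.
  clauseFactor-supported : ∀ c → Supported ℤ.1ℤ (λ j → ∃ λ p → j ≡ combine c p) (clauseFactor c)
  clauseFactor-supported c = supported-⊕
    (supported-mono [ [ (0F ,_) , (1F ,_) ]′ , (2F ,_) ]′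
      (supported-⊗ [ distinct (λ ()) , distinct (λ ()) ]′
        (supported-⊗ (distinct (λ ())) (X-1 0F) (X-1 1F)) (X-1 2F)))
    supported-const
    where
    distinct : ∀ {p q : Fin 3} {j} → p ≢ q → j ≡ combine c p → j ≡ combine c q → ⊥
    distinct {p} {q} p≢q ≡.refl eq = p≢q (Fin.combine-injectiveʳ c p c q eq)
    X-1 : ∀ p → Supported ℤ.1ℤ (_≡ combine c p) (X[ combine c p ]^ (+ 1) ⊕ const (- 1#))
    X-1 p = supported-⊕ (supported-X (combine c p)) supported-const

  variableFactor-supported : ∀ s → Supported ℤ.-1ℤ (λ j → var j ≡ s) (variableFactor s)
  variableFactor-supported s = supported-⊕ (literals ε) (literals (λ a → - ε a))
    where
    -- The support ignores coefficients, so an arbitrary `b` covers both signs of ε.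
    literal : ∀ b a → Supported ℤ.-1ℤ (_≡ a) ((const b ⊗ X[ a ]^ -[1+ 0 ]) ⊕ const 1#)
    literal b a = supported-⊕
      (supported-mono [ (λ ()) , id ]′ (supported-⊗ {P = λ _ → ⊥} (λ ()) supported-const (supported-X a)))
      supported-const
    occurrences-var : All (λ a → var a ≡ s) (occurrences s)
    occurrences-var = All.all-filter (λ a → var a Fin.≟ s) (List.allFin (M ℕ.* 3))
    literals : ∀ (b : Fin (M ℕ.* 3) → Carrier) → Supported ℤ.-1ℤ (λ j → var j ≡ s)
      (∏ (List.map (λ a → (const (b a) ⊗ X[ a ]^ -[1+ 0 ]) ⊕ const 1#) (occurrences s)))
    literals b = supported-mono (λ j∈occ → All.lookup occurrences-var j∈occ)
      (supported-∏ (λ x≢y j≡x j≡y → x≢y (≡.trans (≡.sym j≡x) j≡y)) (λ a → literal (b a) a)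
        (Unique.filter⁺ (λ a → var a Fin.≟ s) (Unique.allFin⁺ (M ℕ.* 3))))

  f-isSignPolynomial : IsSignPolynomial f
  f-isSignPolynomial = All.++⁺
    (signPolynomial-⊗
      -- As `_⊗_` associates to the left, the scalar prefactor joins the product of the clauses; its
      -- support is empty.
      (supported-⊗ {P = λ _ → ⊥} (λ ()) supported-const
        (supported-∏ (λ { c≢d (p , ≡.refl) (q , eq) → c≢d (Fin.combine-injectiveˡ _ p _ q eq) })
          clauseFactor-supported (Unique.allFin⁺ M)))
      (supported-∏ (λ s≢t v≡s v≡t → s≢t (≡.trans (≡.sym v≡s) v≡t))
        variableFactor-supported (Unique.allFin⁺ N)))
    signPolynomial-const

-- Interchanging the sum over m with the sum over the monomials.

module SumExchange {c ℓ : Level} (R : CommutativeRing c ℓ) where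
  open CommutativeRing R
  open RingOps R
  open CommutativeRingLemmas R
  open Algebra.Properties.Semiring.Mult semiring using (×-assoc-*; ×-congʳ)
  open Relation.Binary.Reasoning.Setoid setoid

  sum-const : ∀ l x → sum {l} (λ _ → x) ≈ fromℕ l * x
  sum-const l x = trans (sum-replicate l)
    (sym (trans (×-assoc-* l 1# x) (×-congʳ l (*-identityˡ x))))

  sum-vanishing : ∀ l {K} (q : Fin K → Carrier) (r : Fin K → Fin l → Carrier) C →
    (∀ k → sum (r k) ≈ 0#) → sum (λ m → sum (λ k → q k * r k m) + C) ≈ fromℕ l * C
  sum-vanishing l {K} q r C r≈0 = begin
    sum (λ m → sum (λ k → q k * r k m) + C)
      ≈⟨ ∑-distrib-+ (λ m → sum (λ k → q k * r k m)) (λ _ → C) ⟩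
    sum (λ m → sum (λ k → q k * r k m)) + sum {l} (λ _ → C)
      ≈⟨ +-cong (∑-comm (λ m k → q k * r k m)) (sum-const l C) ⟩
    sum (λ k → sum (λ m → q k * r k m)) + fromℕ l * C
      ≈⟨ +-congʳ (trans (sum-cong-≋ {K} (λ k → trans (sym (*-distribˡ-sum (q k) (r k)))
           (trans (*-congˡ (r≈0 k)) (zeroʳ (q k))))) (sum-replicate-zero K)) ⟩
    0# + fromℕ l * C
      ≈⟨ +-identityˡ _ ⟩
    fromℕ l * C ∎

-- Summation of the logical formula over the l-th roots of unity.

mainTheorem15 :
  ∀ {c ℓ₁ ℓ₂ ℓ₃} (R : RealNumbers c ℓ₁ ℓ₂ ℓ₃) →
  let module ℝ = RealNumbers R
      open ComplexNumbers R
      open CommutativeRing ℂ-ring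
      open RingOps ℂ-ring
  in
  (exp : ℂ → ℂ) → IsExp exp →
  (π : ℝ.Carrier) → IsPi exp π →
  (M N : ℕ) (φ : CNF₃ M N) →
  let n = M ℕ.* 3
      open LaurentPolynomials ℂ-ring n
      open LogicalFormula ℂ-ring (ofReal (ℝ.recip 2)) φ using (f)
      C = constantTerm f
  in
  (enum : SignVectorEnumeration n) →
  let e = SignVectorEnumeration.vec enum
      q = λ k → coeff f (e k)
  in
  (a : Fin n → ℝ.Carrier) →
  (∀ j j′ → j ≢ j′ → ¬ (a j ℝ.≈ a j′)) →
  (z : Fin n → ℤ) → IsIntegerization R a z →
  let zA = λ k → combination (e k) z in
  (l : ℕ) .{{_ : NonZero l}} →
  (∀ k → (1 ℕ.≤ ∣ zA k ∣) × (∣ zA k ∣ ℕ.< l)) →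
  let X : Fin l → Fin n → ℂ
      X m j = expAt exp π l (z j) (suc (toℕ m))
  in
  Σ (∀ m j → IsUnit (X m j)) λ X-unit →
    (sum (λ m → eval f (X m) (X-unit m))
      ≈ sum {l} (λ m → sum (λ k → q k * expAt exp π l (zA k) (suc (toℕ m))) + C))
    × (sum {l} (λ m → sum (λ k → q k * expAt exp π l (zA k) (suc (toℕ m))) + C)
      ≈ fromℕ l * C)
mainTheorem15 R exp isExp π isPi M N φ enum a _ z _ l zA-bound =
  (λ m j → Root.E-unit m (z j)) ,
  sum-cong-≋ {l} (λ m → trans
    (eval≈expansion (X m) (λ j → Root.E-unit m (z j)) enum f-isSignPolynomial)
    (+-congʳ (sum-cong-≋ {3 ℕ.^ n ℕ.∸ 1} λ k → *-congˡ {coeff f (vec k)} (Root.E-power m z (vec k))))) ,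
  sum-vanishing l (λ k → coeff f (vec k)) (λ k m → root l (zA k) (suc (toℕ m))) (constantTerm f)
    (λ k → sum-root≈0 l (zA k) (proj₁ (zA-bound k)) (proj₂ (zA-bound k)))
  where
  open ComplexNumbers R
  n = M ℕ.* 3
  ½ = ofReal (RealNumbers.recip R 2)
  open CommutativeRing ℂ-ring
  open CommutativeRingLemmas ℂ-ring using (sum-cong-≋)
  open SumExchange ℂ-ring
  open UnitCircle R exp isExp π isPi
  open LaurentPolynomials ℂ-ring n
  open LaurentLemmas ℂ-ring n
  open LogicalFormula ℂ-ring ½ φ using (f)
  open LogicalFormulaLemmas ℂ-ring ½ φ using (f-isSignPolynomial)
  open SignVectorEnumeration enum using (vec)
  zA : Fin (3 ℕ.^ n ℕ.∸ 1) → ℤ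
  zA k = combination (vec k) z
  X : Fin l → Fin n → ℂ
  X m j = root l (z j) (suc (toℕ m))
  -- For fixed m the map sending w to exp(i w 2πm/l) is a character of the integers; `suc` lets m
  -- run from 1 to l.
  module Root (m : Fin l) = Character (λ w → root l w (suc (toℕ m)))
    (λ v w → root-+ l v w (suc (toℕ m))) (root-0 l (suc (toℕ m)))
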